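{- Let $\mathfrak M=(\Sigma;R_1,\dots,R_k)$ be a relational structure with $|\Sigma|\ge2$. (1) For every $n\ge1$ and every relation $R\subseteq(\Sigma^*)^n$, $R$ is $\mathfrak M$-recognizable if and only if $R$ is first-order definable in $S_{\mathfrak M}$. (2) The first-order theory of $S_{\mathfrak M}$ is (effectively) reducible to the first-order theory of $\mathfrak M$.
   Context: Let $\mathfrak M=(\Sigma;R_1,\dots,R_k)$ be a structure with finitely many relations, $\mathfrak L$ its language. Let $\#\notin\Sigma$ and let $\mathfrak M_\#$ be the $\mathfrak L\cup\{P_\#\}$-structure with domain $\Sigma\cup\{\#\}$, every symbol of $\mathfrak L$ interpreted as in $\mathfrak M$ and $P_\#(x)$ holding iff $x=\#$. For $w=(w_1,\dots,w_n)\in(\Sigma^*)^n$, $\langle w\rangle$ is the word over $(\Sigma\cup\{\#\})^n$ of length $\max_i|w_i|$ obtained by right-padding each $w_i$ with $\#$'s and reading them in parallel. An $\mathfrak M$-automaton with $n$ tapes is $(Q,n,E,I,T)$ with $Q$ a finite set of states, $I,T\subseteq Q$, and a finite set of transitions $E\subseteq Q\times\mathcal F_n\times Q$, $\mathcal F_n$ the set of first-order $\mathfrak L\cup\{P_\#\}$-formulas with $n$ free variables; $w$ is accepted if, writing $\langle w\rangle=u_0\cdots u_{m-1}$, there are states $q_0\in I,q_1,\dots,q_m\in T$ such that for each $i<m$ some $(q_i,\varphi,q_{i+1})\in E$ satisfies $\mathfrak M_\#\models\varphi(u_i)$. $R\subseteq(\Sigma^*)^n$ is $\mathfrak M$-recognizable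 if it is the set of tuples accepted by some $\mathfrak M$-automaton with $n$ tapes. $S_{\mathfrak M}=(\Sigma^*;EqLength,\preceq,A_{R_1},\dots,A_{R_k},A_=)$ where $EqLength(x,y)$ iff $|x|=|y|$; $x\preceq y$ iff $x$ is a prefix of $y$; for $R_i$ of arity $n$, $A_{R_i}(x_1,\dots,x_n)$ iff there are $w_1,\dots,w_n\in\Sigma^*$ all of the same length and $a_1,\dots,a_n\in\Sigma$ with $x_j=w_ja_j$ for all $j$ and $(a_1,\dots,a_n)\in R_i^{\mathfrak M}$; $A_=(x,y)$ iff $x,y$ are nonempty, of the same length, and have the same last letter. -}

module Defs where

open import Data.Fin using (Fin; zero; suc; inject₁; fromℕ)
open import Data.Fin.Subset using (Subset) renaming (_∈_ to _∈ₛ_)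
open import Data.List using (List; []; length; head; last; drop; applyUpTo; lookup; _∷ʳ_)
open import Data.List.Membership.Propositional using (_∈_)
open import Data.List.Relation.Binary.Prefix.Heterogeneous using (Prefix)
open import Data.Maybe using (Maybe; just; nothing)
open import Data.Nat using (ℕ; zero; suc; _⊔_)
open import Data.Product using (Σ-syntax; ∃-syntax; _×_; _,_)
open import Data.Sum using (_⊎_)
open import Data.Vec as Vec using (Vec; []; _∷_)
open import Function.Bundles using (_⇔_)
open import Level using (0ℓ)
open import Relation.Binary.PropositionalEquality using (_≡_; _≢_)
open import Relation.Nullary using (¬_)
open import Relation.Unary using (Pred)

------------------------------------------------------------------------
-- First-order logic with equality over a relational language

record Language : Set₁ where
  field
    Symbol : Set
    arity  : Symbol → ℕ

open Language public

-- The language of a structure (Σ; R₁, …, R_k), where R_i has arity ar i.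
relational : (k : ℕ) → (Fin k → ℕ) → Language
relational k ar = record { Symbol = Fin k ; arity = ar }

infix  8 _≐_
infix  7 ∼_
infixr 6 _∧′_
infixr 5 _∨′_
infixr 4 _⇒′_

-- Formulas whose free variables are among n variables.  Variables are
-- de Bruijn indices: a quantifier binds the index zero.
data Formula (L : Language) : ℕ → Set where
  rel  : ∀ {n} (r : Symbol L) → Vec (Fin n) (arity L r) → Formula L n
  _≐_  : ∀ {n} → Fin n → Fin n → Formula L n
  ∼_   : ∀ {n} → Formula L n → Formula L n
  _∧′_ : ∀ {n} → Formula L n → Formula L n → Formula L n
  _∨′_ : ∀ {n} → Formula L n → Formula L n → Formula L n
  _⇒′_ : ∀ {n} → Formula L n → Formula L n → Formula L n
  all′ : ∀ {n} → Formula L (suc n) → Formula L n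
  ex′  : ∀ {n} → Formula L (suc n) → Formula L n

Sentence : Language → Set
Sentence L = Formula L 0

record Structure (L : Language) : Set₁ where
  field
    Carrier : Set
    ⟦_⟧     : (r : Symbol L) → Pred (Vec Carrier (arity L r)) 0ℓ

open Structure public

infix 3 _⊨_[_]

_⊨_[_] : ∀ {L n} (M : Structure L) → Formula L n → Vec (Carrier M) n → Set
M ⊨ rel r xs [ ρ ] = ⟦ M ⟧ r (Vec.map (Vec.lookup ρ) xs)
M ⊨ x ≐ y    [ ρ ] = Vec.lookup ρ x ≡ Vec.lookup ρ y
M ⊨ ∼ φ      [ ρ ] = ¬ (M ⊨ φ [ ρ ])
M ⊨ φ ∧′ ψ   [ ρ ] = (M ⊨ φ [ ρ ]) × (M ⊨ ψ [ ρ ])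
M ⊨ φ ∨′ ψ   [ ρ ] = (M ⊨ φ [ ρ ]) ⊎ (M ⊨ ψ [ ρ ])
M ⊨ φ ⇒′ ψ   [ ρ ] = (M ⊨ φ [ ρ ]) → (M ⊨ ψ [ ρ ])
M ⊨ all′ φ   [ ρ ] = (a : Carrier M) → M ⊨ φ [ a ∷ ρ ]
M ⊨ ex′ φ    [ ρ ] = Σ[ a ∈ Carrier M ] (M ⊨ φ [ a ∷ ρ ])

Theory : ∀ {L} → Structure L → Pred (Sentence L) 0ℓ
Theory M φ = M ⊨ φ [ [] ]

Definable : ∀ {L n} (M : Structure L) → Pred (Vec (Carrier M) n) 0ℓ → Set
Definable {L} {n} M R = Σ[ φ ∈ Formula L n ] (∀ w → R w ⇔ (M ⊨ φ [ w ]))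

-- f is a many-one reduction of P to Q.
_Reduces_to_ : {A B : Set} → (A → B) → Pred A 0ℓ → Pred B 0ℓ → Set
f Reduces P to Q = ∀ x → P x ⇔ Q (f x)

AtLeastTwo : Set → Set
AtLeastTwo A = Σ[ a ∈ A ] Σ[ b ∈ A ] a ≢ b

------------------------------------------------------------------------
-- The structure M_#.  Its domain Σ ∪ {#} is Maybe Σ, with # = nothing.

data Symbol# (L : Language) : Set where
  old : Symbol L → Symbol# L
  P#  : Symbol# L

_# : Language → Language
Symbol (L #)          = Symbol# L
arity  (L #) (old r)  = arity L r
arity  (L #) P#       = 1

-- A relation of M, viewed on the larger domain, holds of no tuple in which
-- # occurs.
extend : ∀ {L} → Structure L → Structure (L #)
Carrier (extend M) = Maybe (Carrier M)
⟦ extend M ⟧ (old r) v        = ∃[ a ] (v ≡ Vec.map just a × ⟦ M ⟧ r a)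
⟦ extend M ⟧ P#      (x ∷ []) = x ≡ nothing

------------------------------------------------------------------------
-- Convolution of a tuple of words

maxLength : ∀ {A : Set} {n} → Vec (List A) n → ℕ
maxLength w = Vec.foldr′ _⊔_ 0 (Vec.map length w)

-- The i-th letter (counting from 0) of w # # # …
letter : ∀ {A : Set} → ℕ → List A → Maybe A
letter i w = head (drop i w)

⟨_⟩ : ∀ {A : Set} {n} → Vec (List A) n → List (Vec (Maybe A) n)
⟨ w ⟩ = applyUpTo (λ i → Vec.map (letter i) w) (maxLength w)

------------------------------------------------------------------------
-- M-automata.  They depend on M only through its language.

record Automaton (L : Language) (n : ℕ) : Set where
  field
    size        : ℕ
    transitions : List (Fin size × Formula (L #) n × Fin size)
    initial     : Subset size
    terminal    : Subset size

Accepts : ∀ {L n} (M : Structure L) → Automaton L n →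
          Pred (Vec (List (Carrier M)) n) 0ℓ
Accepts M 𝒜 w =
  Σ[ q ∈ (Fin (suc (length ⟨ w ⟩)) → Fin size) ]
    (q zero ∈ₛ initial) ×
    (q (fromℕ (length ⟨ w ⟩)) ∈ₛ terminal) ×
    (∀ (i : Fin (length ⟨ w ⟩)) →
       ∃[ φ ] ((q (inject₁ i) , φ , q (suc i)) ∈ transitions ×
               (extend M ⊨ φ [ lookup ⟨ w ⟩ i ])))
  where open Automaton 𝒜

Recognizable : ∀ {L n} (M : Structure L) →
               Pred (Vec (List (Carrier M)) n) 0ℓ → Set
Recognizable {L} {n} M R = Σ[ 𝒜 ∈ Automaton L n ] (∀ w → R w ⇔ Accepts M 𝒜 w)

------------------------------------------------------------------------
-- The structure S_M

data SymbolS (L : Language) : Set where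
  eqLength prefix eqLast : SymbolS L
  lastLetters            : Symbol L → SymbolS L

𝕊ᴸ : Language → Language
Symbol (𝕊ᴸ L)                 = SymbolS L
arity  (𝕊ᴸ L) eqLength        = 2
arity  (𝕊ᴸ L) prefix          = 2
arity  (𝕊ᴸ L) eqLast          = 2
arity  (𝕊ᴸ L) (lastLetters r) = arity L r

-- lastLetters r is A_r, and eqLast is A_=.
𝕊 : ∀ {L} → Structure L → Structure (𝕊ᴸ L)
Carrier (𝕊 M) = List (Carrier M)
⟦ 𝕊 M ⟧ eqLength (x ∷ y ∷ []) = length x ≡ length y
⟦ 𝕊 M ⟧ prefix   (x ∷ y ∷ []) = Prefix _≡_ x y
⟦ 𝕊 M ⟧ eqLast   (x ∷ y ∷ []) =
  x ≢ [] × y ≢ [] × length x ≡ length y × last x ≡ last y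
⟦ 𝕊 M ⟧ (lastLetters r) xs    =
  ∃[ w ] ∃[ a ]
    ((∀ i j → length (Vec.lookup w i) ≡ length (Vec.lookup w j)) ×
     xs ≡ Vec.zipWith _∷ʳ_ w a ×
     ⟦ M ⟧ r a)

{-# OPTIONS --safe #-}

-- Let the relation accepted from a state q of an automaton be P q.  Membership
-- of w in P q is determined by the first column of ⟨ w ⟩ and the relations P q′
-- of the tuple of tails, so correctness of a construction on automata amounts
-- to a property of one family of relations under taking tails.
--
-- From formulas to automata: complementation is the subset construction and an
-- existential quantifier is a projection.  The projected word may outlast the
-- others, so that acceptance of a state depends on M; it is a least fixed point
-- over the finite set of states and hence a sentence about M.  Automata whose
-- terminal states are selected by sentences are thus uniform in M.  For a
-- sentence of S_M there are no tapes, and the sentence selecting the initial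
-- state is the reduction.
--
-- From automata to formulas: a set of positions is coded by a pair of words, as
-- the positions where their letters agree; two letters suffice for this.  The
-- automaton accepts when some assignment of such sets to the states contains
-- the initial position and is closed under following a transition.
module Submission where

open import Defs
open import Axiom.ExcludedMiddle using (ExcludedMiddle)
open import Data.Bool using (Bool; true; false; T; if_then_else_)
open import Data.Bool.Properties using (T-≡)
open import Data.Empty using (⊥; ⊥-elim)
open import Data.Fin using (Fin; zero; suc; inject₁; fromℕ; _↑ˡ_; _↑ʳ_; finToFun; funToFin)
open import Data.Fin.Properties using (_≟_; 1↔⊤; 2↔Bool; *↔×; finToFun-funToFin)
open import Data.Fin.Subset using (⁅_⁆) renaming (_∈_ to _∈ₛ_)
open import Data.Fin.Subset.Properties using (_∈?_; x∈⁅x⁆; x∈⁅y⁆⇒x≡y)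
open import Data.List as List
  using (List; []; _∷_; length; head; drop; take; last; applyUpTo; allFin;
    cartesianProductWith; _∷ʳ_)
open import Data.List.Membership.Propositional using (_∈_)
open import Data.List.Membership.Propositional.Properties
  using (∈-allFin; ∈-lookup; ∈-cartesianProductWith⁺; ∈-cartesianProductWith⁻)
open import Data.List.Properties using (length-drop; drop-drop; drop-[])
open import Data.List.Relation.Binary.Prefix.Heterogeneous using (Prefix; []; _∷_)
open import Data.List.Relation.Unary.Any using (index)
open import Data.List.Relation.Unary.Any.Properties using (lookup-index)
open import Data.Maybe as Maybe using (Maybe; just; nothing; is-nothing; maybe′)
open import Data.Maybe.Properties using (just-injective) renaming (map-∘ to maybe-map-∘)
open import Data.Nat
  using (ℕ; zero; suc; pred; _≤_; _<_; z<s; s<s; s<s⁻¹; _⊔_; _∸_; _+_; _*_; _^_;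
    ≢-nonZero)
open import Data.Nat.Properties
  using (n≤0⇒n≡0; m≤m⊔n; m≤n⊔m; 0∸n≡0; ∸-distribʳ-⊔; suc-pred; +-comm; pred[m∸n]≡m∸[1+n];
    m∸n≢0⇒n<m; suc-injective)
open import Data.Product using (Σ-syntax; ∃-syntax; ∃; _×_; _,_; proj₁; proj₂)
open import Data.Product.Function.NonDependent.Propositional using (_×-⇔_; _×-↔_)
open import Data.Sum using (_⊎_; inj₁; inj₂; [_,_]′)
open import Data.Sum.Function.Propositional using (_⊎-⇔_)
open import Data.Unit using (⊤; tt)
open import Data.Vec as Vec using (Vec; []; _∷_; lookup; replicate; _++_)
open import Data.Vec.Properties
  using (map-id; map-cong; map-∘; lookup-map; lookup-++ˡ; lookup-++ʳ; map-replicate;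
    lookup-replicate; lookup-zipWith; tabulate∘lookup; lookup∘tabulate; []=⇒lookup;
    lookup⇒[]=; tabulate-cong)
open import Function using (_∘_; id; case_of_)
open import Function.Bundles using (_⇔_; mk⇔; Equivalence; _↔_; Inverse)
open import Function.Construct.Composition using (_⇔-∘_; _↔-∘_)
open import Function.Construct.Identity using (⇔-id; ↔-id)
open import Function.Construct.Symmetry using (⇔-sym)
open import Function.Related.TypeIsomorphisms using (→-cong-⇔; ¬-cong-⇔)
open import Level using (0ℓ)
open import Relation.Binary.PropositionalEquality
  using (_≡_; _≢_; refl; sym; trans; cong; cong₂; subst; subst₂; module ≡-Reasoning)
open import Relation.Nullary using (¬_; Dec; yes; no; contradiction)
open import Relation.Nullary.Decidable using (toWitness; fromWitness; decidable-stable; isYes)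
open import Relation.Unary using (Pred)

open Equivalence using (to; from)

private variable
  L : Language
  m n s : ℕ
  A B : Set

-- Logical equivalences and finite connectives.

∀-cong : {P Q : A → Set} → (∀ x → P x ⇔ Q x) → (∀ x → P x) ⇔ (∀ x → Q x)
∀-cong eq = mk⇔ (λ h x → to (eq x) (h x)) (λ h x → from (eq x) (h x))

∃-cong : {P Q : A → Set} → (∀ x → P x ⇔ Q x) → ∃ P ⇔ ∃ Q
∃-cong eq = mk⇔ (λ (x , h) → x , to (eq x) h) (λ (x , h) → x , from (eq x) h)

-- For `n` zero no variable is at hand, so truth is written with a quantifier; the universal one is
-- valid in every structure.
⊤′ ⊥′ : Formula L n
⊤′ = all′ (zero ≐ zero)
⊥′ = ∼ ⊤′

-- Kept abstract so that the connected formulas can be inferred.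
abstract
  ⌜_⌝ : Bool → Formula L n
  ⌜ b ⌝ = if b then ⊤′ else ⊥′

  ⋀ ⋁ : (Fin s → Formula L n) → Formula L n
  ⋀ {s = zero}  f = ⊤′
  ⋀ {s = suc _} f = f zero ∧′ ⋀ (f ∘ suc)
  ⋁ {s = zero}  f = ⊥′
  ⋁ {s = suc _} f = f zero ∨′ ⋁ (f ∘ suc)

  ⋀[_] ⋁[_] : Fin s ↔ A → (A → Formula L n) → Formula L n
  ⋀[ e ] f = ⋀ (f ∘ Inverse.to e)
  ⋁[ e ] f = ⋁ (f ∘ Inverse.to e)

module _ {M : Structure L} {ρ : Vec (Carrier M) n} where abstract

  ⌜⌝-sem : ∀ {b} → (M ⊨ ⌜ b ⌝ [ ρ ]) ⇔ T b
  ⌜⌝-sem {true}  = mk⇔ (λ _ → tt) (λ _ _ → refl)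
  ⌜⌝-sem {false} = mk⇔ (λ f → f (λ _ → refl)) (λ ())

  ⋀-sem : {f : Fin s → Formula L n} → (M ⊨ ⋀ f [ ρ ]) ⇔ (∀ i → M ⊨ f i [ ρ ])
  ⋀-sem {s = zero}  = mk⇔ (λ _ ()) (λ _ _ → refl)
  ⋀-sem {s = suc _} = mk⇔
    (λ { (h , hs) zero → h ; (h , hs) (suc i) → to ⋀-sem hs i })
    (λ hs → hs zero , from ⋀-sem (hs ∘ suc))

  ⋁-sem : {f : Fin s → Formula L n} → (M ⊨ ⋁ f [ ρ ]) ⇔ (∃[ i ] (M ⊨ f i [ ρ ]))
  ⋁-sem {s = zero}  = mk⇔ (λ h → ⊥-elim (h (λ _ → refl))) (λ ())
  ⋁-sem {s = suc _} = mk⇔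
    [ (λ h → zero , h) , (λ h → let i , hᵢ = to ⋁-sem h in suc i , hᵢ) ]′
    (λ { (zero , h) → inj₁ h ; (suc i , h) → inj₂ (from ⋁-sem (i , h)) })

  ⋀[]-sem : {e : Fin s ↔ A} {f : A → Formula L n} →
            (M ⊨ ⋀[ e ] f [ ρ ]) ⇔ (∀ x → M ⊨ f x [ ρ ])
  ⋀[]-sem {e = e} {f} = mk⇔
    (λ h x → subst (λ y → M ⊨ f y [ ρ ]) (Inverse.strictlyInverseˡ e x)
               (to ⋀-sem h (Inverse.from e x)))
    (λ h → from ⋀-sem (h ∘ Inverse.to e))

  ⋁[]-sem : {e : Fin s ↔ A} {f : A → Formula L n} →
            (M ⊨ ⋁[ e ] f [ ρ ]) ⇔ (∃[ x ] (M ⊨ f x [ ρ ]))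
  ⋁[]-sem {e = e} {f} = mk⇔
    (λ h → let i , hᵢ = to ⋁-sem h in Inverse.to e i , hᵢ)
    (λ (x , h) → from ⋁-sem
      (Inverse.from e x , subst (λ y → M ⊨ f y [ ρ ]) (sym (Inverse.strictlyInverseˡ e x)) h))

-- Elimination of the padding symbol from formulas.

allJust : Vec (Maybe A) n → Maybe (Vec A n)
allJust []            = just []
allJust (nothing ∷ _) = nothing
allJust (just x ∷ v)  = Maybe.map (x ∷_) (allJust v)

-- The atomic case of eliminating #: a single # in the tuple makes an old relation false, and
-- otherwise all entries are letters and the relation of `M` applies.
allJust-map : (f : A → B) (R : Vec B n → Set) (v : Vec (Maybe A) n) →
  (∃[ b ] (Vec.map (Maybe.map f) v ≡ Vec.map just b × R b)) ⇔
  maybe′ (R ∘ Vec.map f) ⊥ (allJust v)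
allJust-map f R [] = mk⇔ (λ { ([] , _ , r) → r }) (λ r → [] , refl , r)
allJust-map f R (nothing ∷ v) = mk⇔ (λ { (_ ∷ _ , () , _) }) (λ ())
-- The first letter is absorbed into the relation, which is why the induction is over arbitrary `R`.
allJust-map f R (just x ∷ v) with allJust v | allJust-map f (R ∘ (f x ∷_)) v
... | just u  | ih = mk⇔
  (λ { (b ∷ bs , eq , r) → to ih
         (bs , cong Vec.tail eq
             , subst (λ c → R (c ∷ bs)) (sym (just-injective (cong Vec.head eq))) r) })
  (λ r → let bs , eq , r′ = from ih r in f x ∷ bs , cong (just (f x) ∷_) eq , r′)
... | nothing | ih = mk⇔
  (λ { (b ∷ bs , eq , r) → to ih
         (bs , cong Vec.tail eq
             , subst (λ c → R (c ∷ bs)) (sym (just-injective (cong Vec.head eq))) r) })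
  (λ ())

equal : Maybe (Fin m) → Maybe (Fin m) → Formula L m
equal (just i) (just j) = i ≐ j
equal nothing  nothing  = ⊤′
equal _        _        = ⊥′

-- v says which variables of φ stand for #.
eliminate# : Formula (L #) n → Vec (Maybe (Fin m)) n → Formula L m
eliminate# (rel (old r) xs)       v = maybe′ (rel r) ⊥′ (allJust (Vec.map (lookup v) xs))
eliminate# (rel P# (x ∷ []))      v = ⌜ is-nothing (lookup v x) ⌝
eliminate# (x ≐ y)                v = equal (lookup v x) (lookup v y)
eliminate# (∼ φ)                  v = ∼ eliminate# φ v
eliminate# (φ ∧′ ψ)               v = eliminate# φ v ∧′ eliminate# ψ v
eliminate# (φ ∨′ ψ)               v = eliminate# φ v ∨′ eliminate# ψ v
eliminate# (φ ⇒′ ψ)               v = eliminate# φ v ⇒′ eliminate# ψ v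
-- The enlarged domain consists of # and the letters, so a quantifier becomes one instance at #
-- together with a quantifier over `M`.
eliminate# (all′ φ)               v =
  eliminate# φ (nothing ∷ v) ∧′ all′ (eliminate# φ (just zero ∷ Vec.map (Maybe.map suc) v))
eliminate# (ex′ φ)                v =
  eliminate# φ (nothing ∷ v) ∨′ ex′ (eliminate# φ (just zero ∷ Vec.map (Maybe.map suc) v))

module _ (M : Structure L) where

  equal-sem : (ρ : Vec (Carrier M) m) (x y : Maybe (Fin m)) →
    (Maybe.map (lookup ρ) x ≡ Maybe.map (lookup ρ) y) ⇔ (M ⊨ equal x y [ ρ ])
  equal-sem ρ (just i) (just j) = mk⇔ just-injective (cong just)
  equal-sem ρ (just i) nothing  = mk⇔ (λ ()) (λ h → ⊥-elim (h (λ _ → refl)))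
  equal-sem ρ nothing  (just j) = mk⇔ (λ ()) (λ h → ⊥-elim (h (λ _ → refl)))
  equal-sem ρ nothing  nothing  = mk⇔ (λ _ _ → refl) (λ _ → refl)

  maybe-rel-sem : (r : Symbol L) (ρ : Vec (Carrier M) m) (x : Maybe (Vec (Fin m) (arity L r))) →
    maybe′ (⟦ M ⟧ r ∘ Vec.map (lookup ρ)) ⊥ x ⇔ (M ⊨ maybe′ (rel r) ⊥′ x [ ρ ])
  maybe-rel-sem r ρ (just _) = mk⇔ id id
  maybe-rel-sem r ρ nothing  = mk⇔ (λ ()) (λ h → h (λ _ → refl))

  is-nothing-sem : (ρ : Vec (Carrier M) m) (x : Maybe (Fin m)) →
    (Maybe.map (lookup ρ) x ≡ nothing) ⇔ (M ⊨ ⌜ is-nothing x ⌝ [ ρ ])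
  is-nothing-sem ρ (just _) = mk⇔ (λ ()) (λ h → ⊥-elim (to ⌜⌝-sem h))
  is-nothing-sem ρ nothing  = mk⇔ (λ _ → from ⌜⌝-sem tt) (λ _ → refl)

  weaken-env : (a : Carrier M) (ρ : Vec (Carrier M) m) (v : Vec (Maybe (Fin m)) n) →
    Vec.map (Maybe.map (lookup ρ)) v ≡
    Vec.map (Maybe.map (lookup (a ∷ ρ))) (Vec.map (Maybe.map suc) v)
  weaken-env a ρ v =
    trans (map-cong maybe-map-∘ v) (map-∘ _ _ v)

  eliminate#-sem : (φ : Formula (L #) n) (v : Vec (Maybe (Fin m)) n) (ρ : Vec (Carrier M) m) →
    (extend M ⊨ φ [ Vec.map (Maybe.map (lookup ρ)) v ]) ⇔ (M ⊨ eliminate# φ v [ ρ ])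
  eliminate#-sem (rel (old r) xs) v ρ =
    maybe-rel-sem r ρ (allJust (Vec.map (lookup v) xs)) ⇔-∘ (allJust-map _ (⟦ M ⟧ r) _ ⇔-∘
    mk⇔ (λ (a , eq , h) → a , trans (sym lookups) eq , h)
        (λ (a , eq , h) → a , trans lookups eq , h))
    where
    lookups : Vec.map (lookup (Vec.map (Maybe.map (lookup ρ)) v)) xs ≡
              Vec.map (Maybe.map (lookup ρ)) (Vec.map (lookup v) xs)
    lookups = trans (map-cong (λ i → lookup-map i _ v) xs) (map-∘ _ _ xs)
  eliminate#-sem (rel P# (x ∷ [])) v ρ
    rewrite lookup-map x (Maybe.map (lookup ρ)) v = is-nothing-sem ρ (lookup v x)
  eliminate#-sem (x ≐ y) v ρ
    rewrite lookup-map x (Maybe.map (lookup ρ)) v | lookup-map y (Maybe.map (lookup ρ)) v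
    = equal-sem ρ (lookup v x) (lookup v y)
  eliminate#-sem (∼ φ)    v ρ = ¬-cong-⇔ (eliminate#-sem φ v ρ)
  eliminate#-sem (φ ∧′ ψ) v ρ = eliminate#-sem φ v ρ ×-⇔ eliminate#-sem ψ v ρ
  eliminate#-sem (φ ∨′ ψ) v ρ = eliminate#-sem φ v ρ ⊎-⇔ eliminate#-sem ψ v ρ
  eliminate#-sem (φ ⇒′ ψ) v ρ = →-cong-⇔ (eliminate#-sem φ v ρ) (eliminate#-sem ψ v ρ)
  eliminate#-sem (all′ φ) v ρ = mk⇔
    (λ h → to (eliminate#-sem φ _ ρ) (h nothing)
         , λ a → to (eliminate#-sem φ _ (a ∷ ρ))
             (subst (λ u → extend M ⊨ φ [ just a ∷ u ]) (weaken-env a ρ v) (h (just a))))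
    (λ { (h , _) nothing → from (eliminate#-sem φ _ ρ) h
       ; (_ , h) (just a) →
           subst (λ u → extend M ⊨ φ [ just a ∷ u ]) (sym (weaken-env a ρ v))
             (from (eliminate#-sem φ _ (a ∷ ρ)) (h a)) })
  eliminate#-sem (ex′ φ)  v ρ = mk⇔
    (λ { (nothing , h) → inj₁ (to (eliminate#-sem φ _ ρ) h)
       ; (just a  , h) → inj₂ (a , to (eliminate#-sem φ _ (a ∷ ρ))
             (subst (λ u → extend M ⊨ φ [ just a ∷ u ]) (weaken-env a ρ v) h)) })
    [ (λ h → nothing , from (eliminate#-sem φ _ ρ) h)
    , (λ (a , h) → just a ,
           subst (λ u → extend M ⊨ φ [ just a ∷ u ]) (sym (weaken-env a ρ v))
             (from (eliminate#-sem φ _ (a ∷ ρ)) h)) ]′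

-- Systems: automata uniform in the structure

-- The states are any enumerated type, so that pairs and sets of states can serve as states without
-- recoding. One formula for each pair of states stands in for a list of transitions.
record System (L : Language) (n : ℕ) : Set₁ where
  field
    State : Set
    size  : ℕ
    enum  : Fin size ↔ State
    start : State
    move  : State → State → Formula (L #) n
    out   : State → Sentence L

open System

heads : Vec (List A) n → Vec (Maybe A) n
heads = Vec.map head

tails : Vec (List A) n → Vec (List A) n
tails = Vec.map (drop 1)

-- P q is the relation accepted from the state q, characterised by its
-- derivatives with respect to the first column.
record Behaviour (M : Structure L) (𝒮 : System L n)
                 (P : State 𝒮 → Pred (Vec (List (Carrier M)) n) 0ℓ) : Set where
  field
    out-sem  : ∀ q → P q (replicate n []) ⇔ (M ⊨ out 𝒮 q [ [] ])
    move-sem : ∀ q w → maxLength w ≢ 0 →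
      P q w ⇔ (∃[ q′ ] ((extend M ⊨ move 𝒮 q q′ [ heads w ]) × P q′ (tails w)))

open Behaviour

Recognizes : (M : Structure L) → System L n → Pred (Vec (List (Carrier M)) n) 0ℓ → Set₁
Recognizes M 𝒮 R =
  Σ[ P ∈ (State 𝒮 → Pred _ 0ℓ) ] Behaviour M 𝒮 P × (∀ w → P (start 𝒮) w ⇔ R w)

recognizes-resp : {M : Structure L} {𝒮 : System L n} {R R′ : Pred (Vec (List (Carrier M)) n) 0ℓ} →
  (∀ w → R w ⇔ R′ w) → Recognizes M 𝒮 R → Recognizes M 𝒮 R′
recognizes-resp R⇔R′ (P , b , P⇔R) = P , b , λ w → R⇔R′ w ⇔-∘ P⇔R w

-- Sets of states, and complementation.

_∋_ : Fin (2 ^ s) → Fin s → Bool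
X ∋ i = Inverse.to 2↔Bool (finToFun X i)

subset : (Fin s → Bool) → Fin (2 ^ s)
subset f = funToFin (Inverse.from 2↔Bool ∘ f)

∋-subset : (f : Fin s → Bool) (i : Fin s) → subset f ∋ i ≡ f i
∋-subset f i = trans (cong (Inverse.to 2↔Bool) (finToFun-funToFin _ i))
                     (Inverse.strictlyInverseˡ 2↔Bool (f i))

module Subsets (𝒮 : System L n) where

  -- Coding sets by numbers makes them an enumerated type: a set can be a state, and a finite
  -- conjunction can range over all sets.
  Subset : Set
  Subset = Fin (2 ^ size 𝒮)

  [_∈_] : ∀ {L m} → State 𝒮 → Subset → Formula L m
  [ q ∈ X ] = ⌜ X ∋ Inverse.from (enum 𝒮) q ⌝

  _∈ˢ_ : State 𝒮 → Subset → Set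
  q ∈ˢ X = T (X ∋ Inverse.from (enum 𝒮) q)

  comprehension : (f : State 𝒮 → Bool) (q : State 𝒮) →
    q ∈ˢ subset (f ∘ Inverse.to (enum 𝒮)) ⇔ T (f q)
  comprehension f q
    rewrite ∋-subset (f ∘ Inverse.to (enum 𝒮)) (Inverse.from (enum 𝒮) q)
          | Inverse.strictlyInverseˡ (enum 𝒮) q = mk⇔ id id

  reached : Subset → State 𝒮 → Formula (L #) n
  reached X q′ = ⋁[ enum 𝒮 ] λ q → [ q ∈ X ] ∧′ move 𝒮 q q′

  module _ (em : ExcludedMiddle 0ℓ) (P : State 𝒮 → Set) where

    -- Excluded middle turns an arbitrary predicate on states into a coded set. Such sets are
    -- witnesses in correctness proofs only, so the construction of systems remains effective.
    classical : Subset
    classical = subset (λ i → isYes (em {P (Inverse.to (enum 𝒮) i)}))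

    ∈-classical : ∀ q → q ∈ˢ classical ⇔ P q
    ∈-classical q = mk⇔
      (λ h → toWitness {a? = em} (to (comprehension (λ q → isYes (em {P q})) q) h))
      (λ h → from (comprehension (λ q → isYes (em {P q})) q) (fromWitness {a? = em} h))

complement : System L n → System L n
complement 𝒮 = record
  { State = Subset
  ; size  = _
  ; enum  = ↔-id _
  ; start = subset (λ i → isYes (i ≟ Inverse.from (enum 𝒮) (start 𝒮)))
  ; move  = λ X X′ → ⋀[ enum 𝒮 ] λ q′ →
      ([ q′ ∈ X′ ] ⇒′ reached X q′) ∧′ (reached X q′ ⇒′ [ q′ ∈ X′ ])
  ; out   = λ X → ⋀[ enum 𝒮 ] λ q → [ q ∈ X ] ⇒′ ∼ out 𝒮 q
  }
  where open Subsets 𝒮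

-- From a set `X` the tuples accepted are those that every member of `X` rejects. By `move-sem` this
-- means that every state reached on the first column rejects the tails, and the moves of
-- `complement` lead exactly to the set of those states.
complement-recognizes : ExcludedMiddle 0ℓ → {M : Structure L} {𝒮 : System L n}
  {R : Pred (Vec (List (Carrier M)) n) 0ℓ} →
  Recognizes M 𝒮 R → Recognizes M (complement 𝒮) (¬_ ∘ R)
complement-recognizes {n = n} em {M} {𝒮} {R} (P , b , P⇔R) = P′ , record
  { out-sem  = λ X → mk⇔
      (λ h → from ⋀[]-sem
        (λ q q∈X → h q (to ⌜⌝-sem q∈X) ∘ from (out-sem b q)))
      (λ h q q∈X → to ⋀[]-sem h q (from ⌜⌝-sem q∈X) ∘ to (out-sem b q))
  ; move-sem = λ X w w≢ε →
      let open Moves X (heads w) in mk⇔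
      (λ h → X′ , from ⋀[]-sem (λ q′ →
               (λ q′∈X′ → from reached-sem (to (∈-classical em Reached q′) (to ⌜⌝-sem q′∈X′)))
             , (λ r → from ⌜⌝-sem (from (∈-classical em Reached q′) (to reached-sem r))))
           , λ q′ q′∈X′ p′ → let q , q∈X , mv = to (∈-classical em Reached q′) q′∈X′ in
               h q q∈X (from (move-sem b q w w≢ε) (q′ , mv , p′)))
      (λ (X′ , mv , h) q q∈X p → let q′ , mv′ , p′ = to (move-sem b q w w≢ε) p in
         h q′ (to ⌜⌝-sem (proj₂ (to ⋀[]-sem mv q′)
                (from reached-sem (q , q∈X , mv′)))) p′)
  } , λ w → mk⇔
    (λ h r → h (start 𝒮) (from start-sem refl) (from (P⇔R w) r))
    (λ ¬r q q∈S p → ¬r (to (P⇔R w) (subst (λ q → P q w) (sym (to start-sem q∈S)) p)))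
  where
  open Subsets 𝒮
  P′ : Subset → Pred _ 0ℓ
  P′ X w = ∀ q → q ∈ˢ X → ¬ P q w

  module Moves (X : Subset) (u : Vec (Maybe (Carrier M)) n) where
    Reached : State 𝒮 → Set
    Reached q′ = ∃[ q ] (q ∈ˢ X × (extend M ⊨ move 𝒮 q q′ [ u ]))
    X′ : Subset
    X′ = classical em Reached
    reached-sem : ∀ {q′} → (extend M ⊨ reached X q′ [ u ]) ⇔ Reached q′
    reached-sem = ∃-cong (λ q → ⌜⌝-sem ×-⇔ ⇔-id _) ⇔-∘ ⋁[]-sem

  start-sem : ∀ {q} → q ∈ˢ start (complement 𝒮) ⇔ (start 𝒮 ≡ q)
  start-sem {q} rewrite ∋-subset (λ i → isYes (i ≟ Inverse.from (enum 𝒮) (start 𝒮))) (Inverse.from (enum 𝒮) q) = mk⇔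
    (λ h → sym (trans (sym (Inverse.strictlyInverseˡ (enum 𝒮) q)) (trans
             (cong (Inverse.to (enum 𝒮)) (toWitness {a? = Inverse.from (enum 𝒮) q ≟ _} h))
             (Inverse.strictlyInverseˡ (enum 𝒮) (start 𝒮)))))
    (λ { refl → fromWitness {a? = Inverse.from (enum 𝒮) q ≟ _} refl })

-- Intersection by the product construction.

intersection : System L n → System L n → System L n
intersection 𝒮 𝒯 = record
  { State = State 𝒮 × State 𝒯
  ; size  = size 𝒮 * size 𝒯
  ; enum  = (enum 𝒮 ×-↔ enum 𝒯) ↔-∘ *↔×
  ; start = start 𝒮 , start 𝒯
  ; move  = λ (p , q) (p′ , q′) → move 𝒮 p p′ ∧′ move 𝒯 q q′
  ; out   = λ (p , q) → out 𝒮 p ∧′ out 𝒯 q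
  }

intersection-recognizes : {M : Structure L} {𝒮 𝒯 : System L n}
  {R S : Pred (Vec (List (Carrier M)) n) 0ℓ} →
  Recognizes M 𝒮 R → Recognizes M 𝒯 S →
  Recognizes M (intersection 𝒮 𝒯) (λ w → R w × S w)
intersection-recognizes (P , b , P⇔R) (Q , c , Q⇔S) =
  (λ (p , q) w → P p w × Q q w) , record
  { out-sem  = λ (p , q) → out-sem b p ×-⇔ out-sem c q
  ; move-sem = λ (p , q) w w≢ε → mk⇔
      (λ (h , k) → let p′ , mv , h′ = to (move-sem b p w w≢ε) h
                       q′ , nv , k′ = to (move-sem c q w w≢ε) k
                   in (p′ , q′) , (mv , nv) , h′ , k′)
      (λ ((p′ , q′) , (mv , nv) , h′ , k′) →
         from (move-sem b p w w≢ε) (p′ , mv , h′) , from (move-sem c q w w≢ε) (q′ , nv , k′))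
  } , λ w → P⇔R w ×-⇔ Q⇔S w

-- Projection of the first tape.

m⊔n≡0⇒m≡0 : ∀ m n → m ⊔ n ≡ 0 → m ≡ 0
m⊔n≡0⇒m≡0 m n eq = n≤0⇒n≡0 (subst (m ≤_) eq (m≤m⊔n m n))

m⊔n≡0⇒n≡0 : ∀ m n → m ⊔ n ≡ 0 → n ≡ 0
m⊔n≡0⇒n≡0 m n eq = n≤0⇒n≡0 (subst (n ≤_) eq (m≤n⊔m m n))

module Projection (𝒮 : System L (suc n)) where
  open Subsets 𝒮

  -- The move from q to q′ reading (a,#,…,#) for some letter a.
  extension : State 𝒮 → State 𝒮 → Sentence L
  extension q q′ = ex′ (eliminate# (move 𝒮 q q′) (just zero ∷ replicate n nothing))

  closed : Subset → Sentence L
  closed X =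
    ⋀[ enum 𝒮 ] (λ q → out 𝒮 q ⇒′ [ q ∈ X ]) ∧′
    ⋀[ enum 𝒮 ] (λ q → ⋀[ enum 𝒮 ] λ q′ → extension q q′ ∧′ [ q′ ∈ X ] ⇒′ [ q ∈ X ])

  -- The existence of an accepting path of extensions is a least fixed point,
  -- hence expressible as membership in every closed set.
  extendable : State 𝒮 → Sentence L
  extendable q = ⋀ λ X → closed X ⇒′ [ q ∈ X ]

  -- The boolean tells whether the projected word has not ended yet.
  project-move : State 𝒮 × Bool → State 𝒮 × Bool → Formula (L #) n
  project-move (q , true)  (q′ , true)  = ex′ (∼ rel P# (zero ∷ []) ∧′ move 𝒮 q q′)
  project-move (q , false) (q′ , true)  = ⊥′
  project-move (q , _)     (q′ , false) = ex′ (rel P# (zero ∷ []) ∧′ move 𝒮 q q′)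

  project-out : State 𝒮 × Bool → Sentence L
  project-out (q , true)  = extendable q
  project-out (q , false) = out 𝒮 q

  projection : System L n
  projection = record
    { State = State 𝒮 × Bool
    ; size  = size 𝒮 * 2
    ; enum  = (enum 𝒮 ×-↔ 2↔Bool) ↔-∘ *↔×
    ; start = start 𝒮 , true
    ; move  = project-move
    ; out   = project-out
    }

  module _ (em : ExcludedMiddle 0ℓ) {M : Structure L}
           {P : State 𝒮 → Pred (Vec (List (Carrier M)) (suc n)) 0ℓ} (b : Behaviour M 𝒮 P) where

    private
      ε : Vec (List (Carrier M)) n
      ε = replicate n []

    Extendable : State 𝒮 → Set
    Extendable q = ∃[ x ] P q (x ∷ ε)

    -- Beyond the ends of the other tapes a column is one letter followed by paddings, so
    -- `eliminate#` leaves a formula of `M` about that letter alone.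
    extension-sem : ∀ q x a → P q ((a ∷ x) ∷ ε) ⇔
      (∃[ q′ ] ((M ⊨ eliminate# (move 𝒮 q q′) (just zero ∷ replicate n nothing) [ a ∷ [] ]) × P q′ (x ∷ ε)))
    extension-sem q x a = mk⇔
      (λ h → let q′ , mv , h′ = to (move-sem b q ((a ∷ x) ∷ ε) ((λ ()) ∘ m⊔n≡0⇒m≡0 (suc (length x)) (maxLength ε))) h in
        q′ , to (eliminate#-sem M (move 𝒮 q q′) _ (a ∷ []))
               (subst (λ u → extend M ⊨ move 𝒮 q q′ [ just a ∷ u ]) column mv)
           , subst (λ v → P q′ (x ∷ v)) (map-replicate (drop 1) [] n) h′)
      (λ (q′ , mv , h′) → from (move-sem b q ((a ∷ x) ∷ ε) ((λ ()) ∘ m⊔n≡0⇒m≡0 (suc (length x)) (maxLength ε)))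
        (q′ , subst (λ u → extend M ⊨ move 𝒮 q q′ [ just a ∷ u ]) (sym column)
                (from (eliminate#-sem M (move 𝒮 q q′) _ (a ∷ [])) mv)
            , subst (λ v → P q′ (x ∷ v)) (sym (map-replicate (drop 1) [] n)) h′))
      where
      column : heads ε ≡ Vec.map (Maybe.map (lookup (a ∷ []))) (replicate n nothing)
      column = trans (map-replicate head [] n) (sym (map-replicate _ nothing n))

    closed-sem : ∀ X → (M ⊨ closed X [ [] ]) ⇔
      ((∀ q → (M ⊨ out 𝒮 q [ [] ]) → q ∈ˢ X) ×
       (∀ q q′ → (M ⊨ extension q q′ [ [] ]) → q′ ∈ˢ X → q ∈ˢ X))
    closed-sem X = mk⇔
      (λ (h , k) → (λ q o → to ⌜⌝-sem (to ⋀[]-sem h q o))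
                 , (λ q q′ e q′∈X → to ⌜⌝-sem
                     (to ⋀[]-sem (to ⋀[]-sem k q) q′
                       (e , from ⌜⌝-sem q′∈X))))
      (λ (h , k) → from ⋀[]-sem (λ q o → from ⌜⌝-sem (h q o))
                 , from ⋀[]-sem (λ q → from ⋀[]-sem
                     (λ q′ (e , q′∈X) → from ⌜⌝-sem (k q q′ e (to ⌜⌝-sem q′∈X)))))

    -- Every closed set contains the extendable states, by induction on the extending word.
    -- Conversely the set of extendable states is itself closed, hence one of the sets in the
    -- conjunction.
    extendable-sem : ∀ q → Extendable q ⇔ (M ⊨ extendable q [ [] ])
    extendable-sem q = mk⇔
      (λ (x , h) → from ⋀-sem (λ X c → from ⌜⌝-sem
         (let k , l = to (closed-sem X) c in stays-in X k l x q h)))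
      (λ h → to (∈-classical em Extendable q) (to ⌜⌝-sem (to ⋀-sem h (classical em Extendable)
         (from (closed-sem _)
           ( (λ q o → from (∈-classical em Extendable q) ([] , from (out-sem b q) o))
           , (λ q q′ (a , e) q′∈X → let x , h = to (∈-classical em Extendable q′) q′∈X in
                from (∈-classical em Extendable q) (a ∷ x , from (extension-sem q x a) (q′ , e , h))))))))
      where
      stays-in : ∀ X → (∀ q → (M ⊨ out 𝒮 q [ [] ]) → q ∈ˢ X) →
        (∀ q q′ → (M ⊨ extension q q′ [ [] ]) → q′ ∈ˢ X → q ∈ˢ X) →
        ∀ x q → P q (x ∷ ε) → q ∈ˢ X
      stays-in X k l []      q h = k q (to (out-sem b q) h)
      stays-in X k l (a ∷ x) q h = let q′ , e , h′ = to (extension-sem q x a) h in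
        l q q′ (a , e) (stays-in X k l x q′ h′)

    projected : State 𝒮 × Bool → Pred (Vec (List (Carrier M)) n) 0ℓ
    projected (q , true)  w = ∃[ x ] P q (x ∷ w)
    projected (q , false) w = P q ([] ∷ w)

    project-behaviour : Behaviour M projection projected
    project-behaviour = record { out-sem = outs ; move-sem = moves }
      where
      outs : ∀ q → projected q ε ⇔ (M ⊨ project-out q [ [] ])
      outs (q , true)  = extendable-sem q
      outs (q , false) = out-sem b q

      moves : ∀ q w → maxLength w ≢ 0 → projected q w ⇔
        (∃[ q′ ] ((extend M ⊨ project-move q q′ [ heads w ]) × projected q′ (tails w)))
      moves (q , true) w w≢ε = mk⇔ forth back
        where
        step : ∀ x → _
        step x = move-sem b q (x ∷ w) (w≢ε ∘ m⊔n≡0⇒n≡0 (length x) _)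
        forth : _
        -- The projected word has ended: its letter is #, and the flag drops to `false` for the rest
        -- of the run.
        forth ([] , h)    = let q′ , mv , h′ = to (step []) h in (q′ , false) , (nothing , refl , mv) , h′
        forth (a ∷ x , h) = let q′ , mv , h′ = to (step (a ∷ x)) h in
          (q′ , true) , (just a , (λ ()) , mv) , x , h′
        back : _
        back ((q′ , true)  , (nothing , nn , mv) , x , h′) = ⊥-elim (nn refl)
        back ((q′ , true)  , (just a , _ , mv) , x , h′)   = a ∷ x , from (step (a ∷ x)) (q′ , mv , h′)
        back ((q′ , false) , (.nothing , refl , mv) , h′)  = [] , from (step []) (q′ , mv , h′)
      moves (q , false) w w≢ε = mk⇔
        (λ h → let q′ , mv , h′ = to (move-sem b q ([] ∷ w) w≢ε) h in
               (q′ , false) , (nothing , refl , mv) , h′)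
        (λ { ((q′ , true) , f , _) → ⊥-elim (f (λ _ → refl))
           ; ((q′ , false) , (.nothing , refl , mv) , h′) →
               from (move-sem b q ([] ∷ w) w≢ε) (q′ , mv , h′) })

open Projection using (projection)

projection-recognizes : ExcludedMiddle 0ℓ → {M : Structure L} {𝒮 : System L (suc n)}
  {R : Pred (Vec (List (Carrier M)) (suc n)) 0ℓ} →
  Recognizes M 𝒮 R → Recognizes M (projection 𝒮) (λ w → ∃[ x ] R (x ∷ w))
projection-recognizes em {𝒮 = 𝒮} (P , b , P⇔R) =
  Projection.projected 𝒮 em b , Projection.project-behaviour 𝒮 em b ,
  λ w → mk⇔ (λ (x , h) → x , to (P⇔R (x ∷ w)) h) (λ (x , h) → x , from (P⇔R (x ∷ w)) h)

-- Words and columns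

lookup-ext : {v w : Vec A n} → (∀ i → lookup v i ≡ lookup w i) → v ≡ w
lookup-ext {v = v} {w} eq =
  trans (sym (tabulate∘lookup v)) (trans (tabulate-cong eq) (tabulate∘lookup w))

maxLength-drop : ∀ i (w : Vec (List A) n) → maxLength (Vec.map (drop i) w) ≡ maxLength w ∸ i
maxLength-drop i []      = sym (0∸n≡0 i)
maxLength-drop i (x ∷ w) = trans
  (cong₂ _⊔_ (length-drop i x) (maxLength-drop i w))
  (sym (∸-distribʳ-⊔ i (length x) (maxLength w)))

maxLength-≡0 : (w : Vec (List A) n) → maxLength w ≡ 0 → w ≡ replicate n []
maxLength-≡0 []       _  = refl
maxLength-≡0 ([] ∷ w) eq = cong ([] ∷_) (maxLength-≡0 w eq)
maxLength-≡0 ((a ∷ x) ∷ w) eq = contradiction (m⊔n≡0⇒m≡0 (suc (length x)) (maxLength w) eq) λ ()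

⟨⟩-empty : (w : Vec (List A) n) → maxLength w ≡ 0 → ⟨ w ⟩ ≡ []
⟨⟩-empty w = cong (applyUpTo _)

applyUpTo-cong : {f g : ℕ → A} → (∀ i → f i ≡ g i) → ∀ m → applyUpTo f m ≡ applyUpTo g m
applyUpTo-cong eq zero    = refl
applyUpTo-cong eq (suc m) = cong₂ _∷_ (eq 0) (applyUpTo-cong (eq ∘ suc) m)

-- Ties the convolution, which is given by positions, to the first column and the tails in terms of
-- which `Behaviour` is stated.
⟨⟩-nonempty : (w : Vec (List A) n) → maxLength w ≢ 0 → ⟨ w ⟩ ≡ heads w ∷ ⟨ tails w ⟩
⟨⟩-nonempty w w≢ε = begin
  applyUpTo column (maxLength w)                          ≡⟨ cong (applyUpTo column) (suc-pred _ {{≢-nonZero w≢ε}}) ⟨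
  heads w ∷ applyUpTo (column ∘ suc) (pred (maxLength w)) ≡⟨ cong (heads w ∷_) (applyUpTo-cong shift _) ⟩
  heads w ∷ applyUpTo column′ (pred (maxLength w))        ≡⟨ cong (λ l → heads w ∷ applyUpTo column′ l)
                                                               (trans (pred≡∸1 (maxLength w)) (sym (maxLength-drop 1 w))) ⟩
  heads w ∷ ⟨ tails w ⟩                                   ∎
  where
  open ≡-Reasoning
  column column′ : ℕ → Vec (Maybe _) _
  column  i = Vec.map (letter i) w
  column′ i = Vec.map (letter i) (tails w)
  pred≡∸1 : ∀ k → pred k ≡ k ∸ 1
  pred≡∸1 zero    = refl
  pred≡∸1 (suc k) = refl
  shift : ∀ i → column (suc i) ≡ column′ i
  shift i = trans (map-cong (λ x → cong head (sym (drop-drop 1 i x))) w) (map-∘ (letter i) (drop 1) w)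

-- Atomic relations

pointwise : Formula (L #) n → System L n
pointwise φ = record
  { State = ⊤
  ; size  = 1
  ; enum  = 1↔⊤
  ; start = tt
  ; move  = λ _ _ → φ
  ; out   = λ _ → ⊤′
  }

-- A relation that is its own derivative, subject to a condition on the two first letters, needs a
-- single state with a loop. `R [] []` lets that state accept at the end.
pointwise-recognizes : {M : Structure L} {φ : Formula (L #) n} {i j : Fin n}
  (C : Maybe (Carrier M) → Maybe (Carrier M) → Set) {R : List (Carrier M) → List (Carrier M) → Set} →
  (∀ u → (extend M ⊨ φ [ u ]) ⇔ C (lookup u i) (lookup u j)) →
  (∀ x y → R x y ⇔ (C (head x) (head y) × R (drop 1 x) (drop 1 y))) → R [] [] →
  Recognizes M (pointwise φ) (λ w → R (lookup w i) (lookup w j))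
pointwise-recognizes {M = M} {φ} {i} {j} C {R} φ-sem derivative R[] = (λ _ → P) , record
  { out-sem  = λ _ → mk⇔ (λ _ _ → refl)
      (λ _ → subst₂ R (sym (lookup-replicate i [])) (sym (lookup-replicate j [])) R[])
  ; move-sem = λ _ w _ → mk⇔ (λ r → tt , to (step w) r) (λ (_ , h) → from (step w) h)
  } , λ w → ⇔-id _
  where
  P : Pred (Vec (List (Carrier M)) _) 0ℓ
  P w = R (lookup w i) (lookup w j)
  columns : ∀ w → (C (head (lookup w i)) (head (lookup w j)) × R (drop 1 (lookup w i)) (drop 1 (lookup w j))) ⇔
                  (C (lookup (heads w) i) (lookup (heads w) j) × P (tails w))
  columns w rewrite lookup-map i head w | lookup-map j head w
                  | lookup-map i (drop 1) w | lookup-map j (drop 1) w = ⇔-id _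
  step : ∀ w → P w ⇔ ((extend M ⊨ φ [ heads w ]) × P (tails w))
  step w = (⇔-sym (φ-sem (heads w)) ×-⇔ ⇔-id _) ⇔-∘ (columns w ⇔-∘ derivative (lookup w i) (lookup w j))

both-derivative : (x y : List A) → (x ≡ y) ⇔ (head x ≡ head y × drop 1 x ≡ drop 1 y)
both-derivative []      []      = mk⇔ (λ _ → refl , refl) (λ _ → refl)
both-derivative []      (_ ∷ _) = mk⇔ (λ ()) (λ ())
both-derivative (_ ∷ _) []      = mk⇔ (λ ()) (λ ())
both-derivative (a ∷ x) (b ∷ y) = mk⇔ (λ { refl → refl , refl }) (λ { (refl , refl) → refl })

SamePadding : Maybe A → Maybe A → Set
SamePadding a b = a ≡ nothing × b ≡ nothing ⊎ a ≢ nothing × b ≢ nothing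

length-derivative : (x y : List A) → (length x ≡ length y) ⇔
  (SamePadding (head x) (head y) × length (drop 1 x) ≡ length (drop 1 y))
length-derivative []      []      = mk⇔ (λ _ → inj₁ (refl , refl) , refl) (λ _ → refl)
length-derivative []      (_ ∷ _) = mk⇔ (λ ()) (λ { (inj₁ (_ , ()) , _) ; (inj₂ (c , _) , _) → contradiction refl c })
length-derivative (_ ∷ _) []      = mk⇔ (λ ()) (λ { (inj₁ (() , _) , _) ; (inj₂ (_ , c) , _) → contradiction refl c })
length-derivative (a ∷ x) (b ∷ y) = mk⇔ (λ eq → inj₂ ((λ ()) , (λ ())) , suc-injective eq) (λ (_ , eq) → cong suc eq)

-- Once `x` has ended, every continuation of `y` is admissible; hence the alternative for a padded
-- first letter.
prefix-derivative : (x y : List A) → Prefix _≡_ x y ⇔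
  ((head x ≡ nothing ⊎ head x ≡ head y) × Prefix _≡_ (drop 1 x) (drop 1 y))
prefix-derivative []      y       = mk⇔ (λ _ → inj₁ refl , []) (λ _ → [])
prefix-derivative (_ ∷ _) []      = mk⇔ (λ ()) (λ { (inj₁ () , _) ; (inj₂ () , _) })
prefix-derivative (a ∷ x) (b ∷ y) = mk⇔
  (λ { (refl ∷ p) → inj₂ refl , p }) (λ { (inj₂ refl , p) → refl ∷ p })

-- `ℓ` is the position of the last letter, counted from zero, and so one less than the length.
EndsAt : ℕ → List A → A → Set
EndsAt ℓ x a = length x ≡ suc ℓ × last x ≡ just a

endsAt-zero : (x : List A) (a : A) → EndsAt 0 x a ⇔ (head x ≡ just a × drop 1 x ≡ [])
endsAt-zero []          a = mk⇔ (λ ()) (λ ())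
endsAt-zero (b ∷ [])    a = mk⇔ (λ (_ , eq) → eq , refl) (λ (eq , _) → refl , eq)
endsAt-zero (b ∷ _ ∷ _) a = mk⇔ (λ ()) (λ ())

endsAt-suc : ∀ ℓ (x : List A) a → EndsAt (suc ℓ) x a ⇔ (head x ≢ nothing × EndsAt ℓ (drop 1 x) a)
endsAt-suc ℓ []          a = mk⇔ (λ ()) (λ ())
endsAt-suc ℓ (b ∷ [])    a = mk⇔ (λ ()) (λ ())
endsAt-suc ℓ (b ∷ c ∷ x) a = mk⇔ (λ (eq , l) → (λ ()) , suc-injective eq , l) (λ (_ , eq , l) → cong suc eq , l)

endsAt-∷ʳ : (x : List A) (a : A) → EndsAt (length x) (x ∷ʳ a) a
endsAt-∷ʳ []          a = refl , refl
endsAt-∷ʳ (b ∷ [])    a = refl , refl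
endsAt-∷ʳ (b ∷ c ∷ x) a = from (endsAt-suc _ (b ∷ c ∷ x ∷ʳ a) a) ((λ ()) , endsAt-∷ʳ (c ∷ x) a)

endsAt-split : ∀ ℓ (x : List A) a → EndsAt ℓ x a → x ≡ take ℓ x ∷ʳ a × length (take ℓ x) ≡ ℓ
endsAt-split zero    (b ∷ [])     a (_ , refl) = refl , refl
endsAt-split (suc ℓ) (b ∷ c ∷ x)  a e with endsAt-split ℓ (c ∷ x) a (proj₂ (to (endsAt-suc ℓ (b ∷ c ∷ x) a) e))
... | eq , len = cong (b ∷_) eq , cong suc len

-- A common form of the relations `lastLetters r` and `eqLast`, with the position and the letters
-- made explicit so that it can be analysed column by column.
LastLetters : (Vec A n → Set) → (Fin n → List A) → Set
LastLetters α x = ∃[ ℓ ] ∃[ a ] (α a × (∀ k → EndsAt ℓ (x k) (lookup a k)))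

lastLetters-cong : (α : Vec A n → Set) {x y : Fin n → List A} → (∀ k → x k ≡ y k) →
  LastLetters α x ⇔ LastLetters α y
lastLetters-cong α eq = ∃-cong λ ℓ → ∃-cong λ a → ⇔-id _ ×-⇔ ∀-cong λ k →
  mk⇔ (subst (λ x → EndsAt ℓ x (lookup a k)) (eq k)) (subst (λ x → EndsAt ℓ x (lookup a k)) (sym (eq k)))

commonLength : (w : Vec (List A) n) → (∀ i j → length (lookup w i) ≡ length (lookup w j)) →
  ∃[ ℓ ] (∀ k → length (lookup w k) ≡ ℓ)
-- Without words any number serves as the common length; this is the case of a nullary relation.
commonLength []      _  = 0 , λ ()
commonLength (x ∷ w) eq = length x , λ k → eq k zero

lastLetters-sem : (M : Structure L) (r : Symbol L) (xs : Vec (List (Carrier M)) (arity L r)) →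
  ⟦ 𝕊 M ⟧ (lastLetters r) xs ⇔ LastLetters (⟦ M ⟧ r) (lookup xs)
lastLetters-sem M r xs = mk⇔
  (λ { (w , a , eq , refl , h) → let ℓ , eqℓ = commonLength w eq in
       ℓ , a , h , λ k → subst₂ (λ l x → EndsAt l x (lookup a k)) (eqℓ k)
         (sym (lookup-zipWith _∷ʳ_ k w a)) (endsAt-∷ʳ (lookup w k) (lookup a k)) })
  (λ (ℓ , a , h , e) →
     let len = λ k → trans (cong length (lookup-map k (take ℓ) xs)) (proj₂ (endsAt-split ℓ _ _ (e k))) in
     Vec.map (take ℓ) xs , a , (λ i j → trans (len i) (sym (len j))) ,
     lookup-ext (λ k → trans (proj₁ (endsAt-split ℓ _ _ (e k)))
       (trans (cong (_∷ʳ lookup a k) (sym (lookup-map k (take ℓ) xs))) (sym (lookup-zipWith _∷ʳ_ k (Vec.map (take ℓ) xs) a)))) , h)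

Equal : Vec A 2 → Set
Equal a = lookup a zero ≡ lookup a (suc zero)

eqLast-sem : (M : Structure L) (x y : List (Carrier M)) →
  ⟦ 𝕊 M ⟧ eqLast (x ∷ y ∷ []) ⇔ LastLetters Equal (lookup (x ∷ y ∷ []))
eqLast-sem M x y = mk⇔
  (λ (x≢[] , _ , len , eq) → let ℓ , a , len′ , eq′ = nonempty x x≢[] in
     ℓ , a ∷ a ∷ [] , refl , λ { zero → len′ , eq′
                               ; (suc zero) → trans (sym len) len′ , trans (sym eq) eq′ })
  (λ { (ℓ , a ∷ .a ∷ [] , refl , e) → let len , eq = e zero ; len′ , eq′ = e (suc zero) in
     (λ { refl → case len of λ () }) , (λ { refl → case len′ of λ () }) ,
     trans len (sym len′) , trans eq (sym eq′) })
  where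
  nonempty : ∀ x → x ≢ [] → ∃[ ℓ ] ∃[ a ] EndsAt ℓ x a
  nonempty []          x≢[] = contradiction refl x≢[]
  nonempty (a ∷ [])    _    = 0 , a , refl , refl
  nonempty (c ∷ b ∷ x) _    = let ℓ , a , e = nonempty (b ∷ x) (λ ()) in
    suc ℓ , a , from (endsAt-suc ℓ (c ∷ b ∷ x) a) ((λ ()) , e)

old-sem : (M : Structure L) (r : Symbol L) (is : Vec (Fin n) (arity L r)) (u : Vec (Maybe (Carrier M)) n) →
  (extend M ⊨ rel (old r) is [ u ]) ⇔
  (∃[ a ] (⟦ M ⟧ r a × (∀ k → lookup u (lookup is k) ≡ just (lookup a k))))
old-sem M r is u = ∃-cong (λ a → mk⇔
  (λ (eq , h) → h , λ k → trans (sym (lookup-map k (lookup u) is))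
                            (trans (cong (λ v → lookup v k) eq) (lookup-map k just a)))
  (λ (h , eq) → lookup-ext (λ k → trans (lookup-map k (lookup u) is)
                            (trans (eq k) (sym (lookup-map k just a)))) , h))

-- In state true the words have not ended yet; φ is read off their last
-- letters.
lastColumn : Vec (Fin n) m → Formula (L #) n → System L n
lastColumn {n = n} is φ = record
  { State = Bool
  ; size  = 2
  ; enum  = 2↔Bool
  ; start = true
  ; move  = λ { true  true  → ⋀ λ k → ∼ rel P# (lookup is k ∷ [])
              ; true  false → φ
              ; false true  → ⊥′
              ; false false → ⋀ λ k → rel P# (lookup is k ∷ []) }
  -- Without words, the relation is nullary and does not depend on the length.
  ; out   = λ { true → eliminate# φ (replicate n nothing) ; false → ⊤′ }
  }

-- The number `ℓ` in `LastLetters` counts the columns during which the run stays in `true` before it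
-- reads `φ`. In `false` the tapes selected by `is` carry only padding.
lastColumn-recognizes : {M : Structure L} {is : Vec (Fin n) m} {φ : Formula (L #) n}
  {α : Vec (Carrier M) m → Set} →
  (∀ u → (extend M ⊨ φ [ u ]) ⇔
         (∃[ a ] (α a × (∀ k → lookup u (lookup is k) ≡ just (lookup a k))))) →
  Recognizes M (lastColumn is φ) (λ w → LastLetters α (λ k → lookup w (lookup is k)))
lastColumn-recognizes {L = L} {n = n} {M = M} {is} {φ} {α} φ-sem =
  P , record { out-sem = outs ; move-sem = moves } , λ w → ⇔-id _
  where
  P : Bool → Pred (Vec (List (Carrier M)) n) 0ℓ
  P true  w = LastLetters α (λ k → lookup w (lookup is k))
  P false w = ∀ k → lookup w (lookup is k) ≡ []

  outs : ∀ q → P q (replicate n []) ⇔ (M ⊨ out (lastColumn is φ) q [ [] ])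
  -- On empty words both sides make an absurd claim about every index `k`. They can hold only for a
  -- nullary relation, where `α` decides both.
  outs true  = eliminate#-sem M φ (replicate n nothing) [] ⇔-∘ mk⇔
    (λ (ℓ , a , h , e) → from (φ-sem _) (a , h , λ k →
      contradiction (trans (sym (cong length (lookup-replicate (lookup is k) []))) (proj₁ (e k))) λ ()))
    (λ h → let a , h′ , eq = to (φ-sem _) h in 0 , a , h′ , λ k →
      contradiction (trans (sym (lookup-replicate (lookup is k) nothing))
        (trans (sym (cong (λ v → lookup v (lookup is k)) (map-replicate _ nothing n))) (eq k))) λ ())
  outs false = mk⇔ (λ _ _ → refl) (λ _ k → lookup-replicate (lookup is k) [])

  head-at : ∀ w k → lookup (heads w) (lookup is k) ≡ head (lookup w (lookup is k))
  head-at w k = lookup-map (lookup is k) head w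

  tail-at : ∀ w k → lookup (tails w) (lookup is k) ≡ drop 1 (lookup w (lookup is k))
  tail-at w k = lookup-map (lookup is k) (drop 1) w

  moves : ∀ q w → maxLength w ≢ 0 → P q w ⇔
    (∃[ q′ ] ((extend M ⊨ move (lastColumn is φ) q q′ [ heads w ]) × P q′ (tails w)))
  moves true w _ = mk⇔ forth back
    where
    forth : P true w → _
    forth (zero , a , h , e) = false
      , from (φ-sem _) (a , h , λ k → trans (head-at w k) (proj₁ (to (endsAt-zero (lookup w (lookup is k)) _) (e k))))
      , λ k → trans (tail-at w k) (proj₂ (to (endsAt-zero (lookup w (lookup is k)) _) (e k)))
    forth (suc ℓ , a , h , e) = true
      , from ⋀-sem (λ k eq → proj₁ (to (endsAt-suc ℓ (lookup w (lookup is k)) _) (e k)) (trans (sym (head-at w k)) eq))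
      , ℓ , a , h , λ k → subst (λ x → EndsAt ℓ x (lookup a k)) (sym (tail-at w k))
                            (proj₂ (to (endsAt-suc ℓ (lookup w (lookup is k)) _) (e k)))
    back : _ → P true w
    back (false , h , ended) = let a , h′ , eq = to (φ-sem _) h in 0 , a , h′ , λ k →
      from (endsAt-zero (lookup w (lookup is k)) _) (trans (sym (head-at w k)) (eq k) , trans (sym (tail-at w k)) (ended k))
    back (true , h , ℓ , a , h′ , e) = suc ℓ , a , h′ , λ k → from (endsAt-suc ℓ (lookup w (lookup is k)) _)
      ( (λ eq → to ⋀-sem h k (trans (head-at w k) eq))
      , subst (λ x → EndsAt ℓ x (lookup a k)) (tail-at w k) (e k))
  moves false w _ = mk⇔
    (λ ended → false
      , from ⋀-sem (λ k → trans (head-at w k) (cong head (ended k)))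
      , λ k → trans (tail-at w k) (cong (drop 1) (ended k)))
    (λ { (true , f , _) → contradiction (λ _ → refl) f
       ; (false , h , ended) k → from (both-derivative _ [])
           (trans (sym (head-at w k)) (to ⋀-sem h k) , trans (sym (tail-at w k)) (ended k)) })

-- From formulas to systems

system : Formula (𝕊ᴸ L) n → System L n
system (rel eqLength (i ∷ j ∷ [])) = pointwise
  (rel P# (i ∷ []) ∧′ rel P# (j ∷ []) ∨′ ∼ rel P# (i ∷ []) ∧′ ∼ rel P# (j ∷ []))
system (rel prefix (i ∷ j ∷ []))   = pointwise (rel P# (i ∷ []) ∨′ i ≐ j)
-- Equality alone would also admit two paddings, so # is excluded.
system (rel eqLast (i ∷ j ∷ []))   = lastColumn (i ∷ j ∷ []) (∼ rel P# (i ∷ []) ∧′ i ≐ j)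
system (rel (lastLetters r) is)    = lastColumn is (rel (old r) is)
system (i ≐ j)                     = pointwise (i ≐ j)
system (∼ φ)                       = complement (system φ)
system (φ ∧′ ψ)                    = intersection (system φ) (system ψ)
system (φ ∨′ ψ)                    =
  complement (intersection (complement (system φ)) (complement (system ψ)))
system (φ ⇒′ ψ)                    = complement (intersection (system φ) (complement (system ψ)))
system (all′ φ)                    = complement (projection (complement (system φ)))
system (ex′ φ)                     = projection (system φ)

module _ (em : ExcludedMiddle 0ℓ) (M : Structure L) where

  letter-of : (x : Maybe A) → x ≢ nothing → ∃[ a ] x ≡ just a
  letter-of (just a) _  = a , refl
  letter-of nothing  x≢ = contradiction refl x≢

  system-recognizes : (φ : Formula (𝕊ᴸ L) n) → Recognizes M (system φ) (λ w → 𝕊 M ⊨ φ [ w ])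
  system-recognizes (rel eqLength (i ∷ j ∷ [])) =
    pointwise-recognizes SamePadding (λ _ → ⇔-id _) length-derivative refl
  system-recognizes (rel prefix (i ∷ j ∷ [])) =
    pointwise-recognizes (λ a b → a ≡ nothing ⊎ a ≡ b) (λ _ → ⇔-id _) prefix-derivative []
  system-recognizes (i ≐ j) =
    pointwise-recognizes _≡_ (λ _ → ⇔-id _) both-derivative refl
  system-recognizes (rel eqLast (i ∷ j ∷ [])) = recognizes-resp
    (λ w → ⇔-sym (eqLast-sem M _ _) ⇔-∘ lastLetters-cong Equal (λ k → sym (lookup-map k (lookup w) (i ∷ j ∷ []))))
    (lastColumn-recognizes (λ u → mk⇔ (λ (u≢# , eq) → let a , eqᵢ = letter-of (lookup u i) u≢# in
         a ∷ a ∷ [] , refl , λ { zero → eqᵢ ; (suc zero) → trans (sym eq) eqᵢ })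
      (λ { (a ∷ .a ∷ [] , refl , eq) →
             (λ u≡# → contradiction (trans (sym u≡#) (eq zero)) λ ()) , trans (eq zero) (sym (eq (suc zero))) })))
  system-recognizes (rel (lastLetters r) is) = recognizes-resp
    (λ w → ⇔-sym (lastLetters-sem M r _) ⇔-∘ lastLetters-cong (⟦ M ⟧ r) (λ k → sym (lookup-map k (lookup w) is)))
    (lastColumn-recognizes (old-sem M r is))
  system-recognizes (∼ φ)    = complement-recognizes em (system-recognizes φ)
  system-recognizes (φ ∧′ ψ) = intersection-recognizes (system-recognizes φ) (system-recognizes ψ)
  system-recognizes (φ ∨′ ψ) = recognizes-resp
    (λ w → mk⇔ (λ h → decidable-stable em (λ ¬∨ → h (¬∨ ∘ inj₁ , ¬∨ ∘ inj₂)))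
               (λ { (inj₁ h) (¬h , _) → ¬h h ; (inj₂ h) (_ , ¬h) → ¬h h }))
    (complement-recognizes em (intersection-recognizes
      (complement-recognizes em (system-recognizes φ))
      (complement-recognizes em (system-recognizes ψ))))
  system-recognizes (φ ⇒′ ψ) = recognizes-resp
    (λ w → mk⇔ (λ h k → decidable-stable em (λ ¬ψ → h (k , ¬ψ))) (λ h (k , ¬ψ) → ¬ψ (h k)))
    (complement-recognizes em (intersection-recognizes (system-recognizes φ)
      (complement-recognizes em (system-recognizes ψ))))
  system-recognizes (all′ φ) = recognizes-resp
    (λ w → mk⇔ (λ h x → decidable-stable em (λ ¬φ → h (x , ¬φ))) (λ h (x , ¬φ) → ¬φ (h x)))
    (complement-recognizes em (projection-recognizes em
      (complement-recognizes em (system-recognizes φ))))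
  system-recognizes (ex′ φ)  = projection-recognizes em (system-recognizes φ)

-- Automata

module _ (M : Structure L) (𝒜 : Automaton L n) where
  open Automaton 𝒜 using (initial; terminal; transitions) renaming (size to states)

  -- Acceptance by recursion on the columns, which fits derivatives better than a run given as a
  -- function.
  AcceptsFrom : Fin states → List (Vec (Maybe (Carrier M)) n) → Set
  AcceptsFrom q []       = q ∈ₛ terminal
  AcceptsFrom q (u ∷ us) = ∃[ q′ ]
    ((∃[ φ ] ((q , φ , q′) ∈ transitions × (extend M ⊨ φ [ u ]))) × AcceptsFrom q′ us)

  RunFrom : Fin states → List (Vec (Maybe (Carrier M)) n) → Set
  RunFrom q₀ us = Σ[ q ∈ (Fin (suc (length us)) → Fin states) ]
    (q zero ≡ q₀) × (q (fromℕ (length us)) ∈ₛ terminal) ×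
    (∀ (i : Fin (length us)) →
       ∃[ φ ] ((q (inject₁ i) , φ , q (suc i)) ∈ transitions × (extend M ⊨ φ [ List.lookup us i ])))

  runFrom⇔ : ∀ q us → RunFrom q us ⇔ AcceptsFrom q us
  runFrom⇔ q [] = mk⇔ (λ { (_ , refl , t , _) → t }) (λ t → (λ _ → q) , refl , t , λ ())
  runFrom⇔ q (u ∷ us) = mk⇔
    (λ { (f , refl , t , mv) → f (suc zero) , mv zero ,
         to (runFrom⇔ _ us) (f ∘ suc , refl , t , mv ∘ suc) })
    (λ (q′ , mv , h) → let f , eq , t , mvs = from (runFrom⇔ q′ us) h in
         (λ { zero → q ; (suc i) → f i }) , refl , t ,
         λ { zero → subst (λ p → ∃[ φ ] ((q , φ , p) ∈ transitions × (extend M ⊨ φ [ u ]))) (sym eq) mv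
           ; (suc i) → mvs i })

  accepts⇔ : ∀ w → Accepts M 𝒜 w ⇔ (∃[ q ] (q ∈ₛ initial × AcceptsFrom q ⟨ w ⟩))
  accepts⇔ w = mk⇔
    (λ (q , i , t , mv) → q zero , i , to (runFrom⇔ _ _) (q , refl , t , mv))
    (λ (q₀ , i , h) → let q , eq , t , mv = from (runFrom⇔ _ _) h in
       q , subst (_∈ₛ initial) (sym eq) i , t , mv)

module _ (em : ExcludedMiddle 0ℓ) (M : Structure L) (𝒮 : System L n) where
  open Inverse (enum 𝒮) using () renaming (to to decode; from to encode; strictlyInverseˡ to decode-encode)

  transition : Fin (size 𝒮) → Fin (size 𝒮) → Fin (size 𝒮) × Formula (L #) n × Fin (size 𝒮)
  transition i j = i , move 𝒮 (decode i) (decode j) , j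

  -- Once `M` is fixed each sentence `out` is true or false, and excluded middle selects the
  -- terminal states accordingly. Only here does the automaton come to depend on `M`.
  automaton : Automaton L n
  automaton = record
    { size        = size 𝒮
    ; transitions = cartesianProductWith transition (allFin (size 𝒮)) (allFin (size 𝒮))
    ; initial     = ⁅ encode (start 𝒮) ⁆
    ; terminal    = Vec.tabulate λ i → isYes (em {M ⊨ out 𝒮 (decode i) [ [] ]})
    }
  open Automaton automaton using (terminal; transitions)

  terminal⇔ : ∀ i → i ∈ₛ terminal ⇔ (M ⊨ out 𝒮 (decode i) [ [] ])
  terminal⇔ i = mk⇔
    (λ h → toWitness {a? = em} (subst T (trans (sym ([]=⇒lookup h)) eq) tt))
    (λ h → lookup⇒[]= i _ (trans eq (to T-≡ (fromWitness {a? = em} h))))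
    where
    eq = lookup∘tabulate (λ i → isYes (em {M ⊨ out 𝒮 (decode i) [ [] ]})) i

  transitions⇔ : ∀ i j u → (∃[ φ ] ((i , φ , j) ∈ transitions × (extend M ⊨ φ [ u ]))) ⇔
    (extend M ⊨ move 𝒮 (decode i) (decode j) [ u ])
  transitions⇔ i j u = mk⇔
    (λ (φ , mem , h) → case ∈-cartesianProductWith⁻ transition (allFin (size 𝒮)) (allFin (size 𝒮)) mem of
       λ { (_ , _ , _ , _ , refl) → h })
    (λ h → _ , ∈-cartesianProductWith⁺ transition (∈-allFin i) (∈-allFin j) , h)

  module _ {P : State 𝒮 → Pred (Vec (List (Carrier M)) n) 0ℓ} (b : Behaviour M 𝒮 P) where

    -- Induction on the number `l` of columns, which passing to the tails lowers by one.
    behaviour⇔ : ∀ l w → maxLength w ≡ l → ∀ i → P (decode i) w ⇔ AcceptsFrom M automaton i ⟨ w ⟩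
    behaviour⇔ zero w eq i rewrite ⟨⟩-empty w eq | maxLength-≡0 w eq =
      ⇔-sym (terminal⇔ i) ⇔-∘ out-sem b (decode i)
    behaviour⇔ (suc l) w eq i = mk⇔
      (λ h → let q′ , mv , h′ = to (move-sem b (decode i) w w≢ε) h
                 eq′ = decode-encode q′ in
         subst (AcceptsFrom M automaton i) (sym (⟨⟩-nonempty w w≢ε))
           ( encode q′
           , from (transitions⇔ i _ _) (subst (λ q → extend M ⊨ move 𝒮 (decode i) q [ heads w ]) (sym eq′) mv)
           , to (ih (encode q′)) (subst (λ q → P q (tails w)) (sym eq′) h′)))
      (λ h → let j , mv , h′ = subst (AcceptsFrom M automaton i) (⟨⟩-nonempty w w≢ε) h in
         from (move-sem b (decode i) w w≢ε) (decode j , to (transitions⇔ i j _) mv , from (ih j) h′))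
      where
      w≢ε : maxLength w ≢ 0
      w≢ε eq₀ = contradiction (trans (sym eq) eq₀) λ ()
      ih = behaviour⇔ l (tails w) (trans (maxLength-drop 1 w) (cong (_∸ 1) eq))

  recognizable : {R : Pred (Vec (List (Carrier M)) n) 0ℓ} → Recognizes M 𝒮 R → Recognizable M R
  recognizable {R} (P , b , P⇔R) = automaton , λ w → ⇔-sym (accepts⇔ M automaton w) ⇔-∘ mk⇔
    (λ r → encode (start 𝒮) , x∈⁅x⁆ _ , to (behaviour⇔ b _ w refl _)
      (subst (λ q → P q w) (sym (decode-encode (start 𝒮))) (from (P⇔R w) r)))
    (λ (i , mem , h) → to (P⇔R w) (subst (λ q → P q w)
      (trans (cong decode (x∈⁅y⁆⇒x≡y _ mem)) (decode-encode (start 𝒮))) (from (behaviour⇔ b _ w refl i) h)))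

-- The reduction of theories, and recognizability of definable relations.

reduce : Sentence (𝕊ᴸ L) → Sentence L
reduce φ = out (system φ) (start (system φ))

-- The only tuple of length zero has no columns, so its acceptance is settled by `out-sem` at the
-- start state.
reduce-reduces : ExcludedMiddle 0ℓ → (M : Structure L) → reduce Reduces (Theory (𝕊 M)) to (Theory M)
reduce-reduces em M φ = let P , b , P⇔φ = system-recognizes em M φ in
  out-sem b (start (system φ)) ⇔-∘ ⇔-sym (P⇔φ [])

definable⇒recognizable : ExcludedMiddle 0ℓ → (M : Structure L) {R : Pred (Vec (List (Carrier M)) n) 0ℓ} →
  Definable (𝕊 M) R → Recognizable M R
definable⇒recognizable em M (φ , R⇔φ) = recognizable em M (system φ)
  (recognizes-resp (λ w → ⇔-sym (R⇔φ w)) (system-recognizes em M φ))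

-- Closure properties of definability

module _ {N : Structure L} where

  definable-resp : {R S : Pred (Vec (Carrier N) n) 0ℓ} → (∀ w → R w ⇔ S w) →
    Definable N R → Definable N S
  definable-resp R⇔S (φ , eq) = φ , λ w → eq w ⇔-∘ ⇔-sym (R⇔S w)

  definable-subst : (R : A → Pred (Vec (Carrier N) n) 0ℓ) {f g : Vec (Carrier N) n → A} →
    (∀ w → f w ≡ g w) → Definable N (λ w → R (f w) w) → Definable N (λ w → R (g w) w)
  definable-subst R eq = definable-resp
    (λ w → mk⇔ (subst (λ a → R a w) (eq w)) (subst (λ a → R a w) (sym (eq w))))

  infixr 6 _∧ᵈ_
  infixr 5 _∨ᵈ_
  infixr 4 _⇒ᵈ_

  ¬ᵈ_ : {R : Pred (Vec (Carrier N) n) 0ℓ} → Definable N R → Definable N (λ w → ¬ R w)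
  ¬ᵈ (φ , eq) = ∼ φ , λ w → ¬-cong-⇔ (eq w)

  _∧ᵈ_ : {R S : Pred (Vec (Carrier N) n) 0ℓ} →
    Definable N R → Definable N S → Definable N (λ w → R w × S w)
  (φ , eq) ∧ᵈ (ψ , eq′) = φ ∧′ ψ , λ w → eq w ×-⇔ eq′ w

  _∨ᵈ_ : {R S : Pred (Vec (Carrier N) n) 0ℓ} →
    Definable N R → Definable N S → Definable N (λ w → R w ⊎ S w)
  (φ , eq) ∨ᵈ (ψ , eq′) = φ ∨′ ψ , λ w → eq w ⊎-⇔ eq′ w

  _⇒ᵈ_ : {R S : Pred (Vec (Carrier N) n) 0ℓ} →
    Definable N R → Definable N S → Definable N (λ w → R w → S w)
  (φ , eq) ⇒ᵈ (ψ , eq′) = (φ ⇒′ ψ) , λ w → →-cong-⇔ (eq w) (eq′ w)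

  ∃ᵈ : {R : Pred (Vec (Carrier N) (suc n)) 0ℓ} →
    Definable N R → Definable N (λ w → ∃[ a ] R (a ∷ w))
  ∃ᵈ (φ , eq) = ex′ φ , λ w → ∃-cong (λ a → eq (a ∷ w))

  ∀ᵈ : {R : Pred (Vec (Carrier N) (suc n)) 0ℓ} →
    Definable N R → Definable N (λ w → ∀ a → R (a ∷ w))
  ∀ᵈ (φ , eq) = all′ φ , λ w → ∀-cong (λ a → eq (a ∷ w))

  ∃ᵈ* : ∀ s {R : Pred (Vec (Carrier N) (s + n)) 0ℓ} →
    Definable N R → Definable N (λ w → Σ[ v ∈ Vec (Carrier N) s ] R (v ++ w))
  ∃ᵈ* zero    d = definable-resp (λ w → mk⇔ ([] ,_) (λ { ([] , h) → h })) d
  ∃ᵈ* (suc s) d = definable-resp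
    (λ w → mk⇔ (λ (v , a , h) → a ∷ v , h) (λ { (a ∷ v , h) → v , a , h })) (∃ᵈ* s (∃ᵈ d))

  ⋀ᵈ : {R : Fin s → Pred (Vec (Carrier N) n) 0ℓ} →
    (∀ i → Definable N (R i)) → Definable N (λ w → ∀ i → R i w)
  ⋀ᵈ d = ⋀ (proj₁ ∘ d) , λ w → ⇔-sym ⋀-sem ⇔-∘ ∀-cong (λ i → proj₂ (d i) w)

  ⋁ᵈ : {R : Fin s → Pred (Vec (Carrier N) n) 0ℓ} →
    (∀ i → Definable N (R i)) → Definable N (λ w → ∃[ i ] R i w)
  ⋁ᵈ d = ⋁ (proj₁ ∘ d) , λ w → ⇔-sym ⋁-sem ⇔-∘ ∃-cong (λ i → proj₂ (d i) w)

  constᵈ : {P : Set} → Dec P → Definable {n = n} N (λ _ → P)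
  constᵈ (yes p) = ⊤′ , λ w → mk⇔ (λ _ _ → refl) (λ _ → p)
  constᵈ (no ¬p) = ⊥′ , λ w → mk⇔ (λ p → contradiction p ¬p) (λ h → ⊥-elim (h (λ _ → refl)))

  ∈ᵈ : {R : A → Pred (Vec (Carrier N) n) 0ℓ} (xs : List A) →
    (∀ x → Definable N (R x)) → Definable N (λ w → ∃[ x ] (x ∈ xs × R x w))
  ∈ᵈ {R = R} xs d = definable-resp
    (λ w → mk⇔ (λ (i , h) → List.lookup xs i , ∈-lookup i , h)
               (λ (x , mem , h) → index mem , subst (λ y → R y w) (lookup-index mem) h))
    (⋁ᵈ (d ∘ List.lookup xs))

-- Letters of words at the position given by the length of a word

-- As a predicate of `i` this is the set of positions coded by the pair `x`, `y`. With `x` in both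
-- places it says that `i` lies inside the word.
Shared : ℕ → List A → List A → Set
Shared i x y = ∃[ a ] (letter i x ≡ just a × letter i y ≡ just a)

-- The signature of `𝕊 M` shows letters only at the ends of words, so an inner letter is reached as
-- the last letter of a prefix.
letter⇔prefix : ∀ i (x : List A) a → (letter i x ≡ just a) ⇔ (∃[ p ] (Prefix _≡_ p x × EndsAt i p a))
letter⇔prefix zero    []      a = mk⇔ (λ ()) (λ { (_ , [] , () , _) })
letter⇔prefix zero    (b ∷ x) a = mk⇔
  (λ { refl → b ∷ [] , refl ∷ [] , refl , refl })
  (λ { (c ∷ [] , refl ∷ _ , _ , eq) → eq })
letter⇔prefix (suc i) []      a = mk⇔ (λ ()) (λ { (_ , [] , () , _) })
letter⇔prefix (suc i) (b ∷ x) a = mk⇔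
  (λ eq → let p , p⪯x , e = to (letter⇔prefix i x a) eq in
     b ∷ p , refl ∷ p⪯x , from (endsAt-suc i (b ∷ p) a) ((λ ()) , e))
  (λ { (c ∷ p , refl ∷ p⪯x , e) →
     from (letter⇔prefix i x a) (p , p⪯x , proj₂ (to (endsAt-suc i (c ∷ p) a) e)) })

-- The covering relation of the prefix order. Being first-order in that order, it supplies the
-- successor of a length.
Covers : List A → List A → Set
Covers p q = Prefix _≡_ q p × q ≢ p × (∀ y → Prefix _≡_ y p → y ≡ p ⊎ Prefix _≡_ y q)

covers-length : (p q : List A) → Covers p q → length p ≡ suc (length q)
covers-length []      q       ([] , q≢p , _)     = contradiction refl q≢p
-- The prefix of one letter is not a prefix of `[]`, so it has to be the whole word.
covers-length (a ∷ p) []      (_ , _ , covers)   with covers (a ∷ []) (refl ∷ [])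
... | inj₁ refl = refl
covers-length (a ∷ p) (b ∷ q) (refl ∷ q⪯p , q≢p , covers) =
  cong suc (covers-length p q (q⪯p , q≢p ∘ cong (a ∷_) , λ y y⪯p → below y (covers (a ∷ y) (refl ∷ y⪯p))))
  where
  below : ∀ y → a ∷ y ≡ a ∷ p ⊎ Prefix _≡_ (a ∷ y) (a ∷ q) → y ≡ p ⊎ Prefix _≡_ y q
  below y (inj₁ refl)      = inj₁ refl
  below y (inj₂ (_ ∷ y⪯q)) = inj₂ y⪯q

covers-take : ∀ ℓ (p : List A) → length p ≡ suc ℓ → Covers p (take ℓ p) × length (take ℓ p) ≡ ℓ
covers-take zero    (a ∷ [])    _  =
  ([] , (λ ()) , λ { [] _ → inj₂ [] ; (_ ∷ []) (refl ∷ []) → inj₁ refl }) , refl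
covers-take (suc ℓ) (a ∷ b ∷ p) eq =
  let (q⪯p , q≢p , covers) , len = covers-take ℓ (b ∷ p) (suc-injective eq) in
  ( refl ∷ q⪯p , q≢p ∘ cong (drop 1)
  , λ { [] _ → inj₂ []
      ; (_ ∷ y) (refl ∷ y⪯p) → [ inj₁ ∘ cong (a ∷_) , inj₂ ∘ (refl ∷_) ]′ (covers y y⪯p) })
  , cong suc len

module _ (M : Structure L) where

  prefixᵈ : (i j : Fin n) → Definable (𝕊 M) (λ ρ → Prefix _≡_ (lookup ρ i) (lookup ρ j))
  prefixᵈ i j = rel prefix (i ∷ j ∷ []) , λ _ → ⇔-id _

  equalᵈ : (i j : Fin n) → Definable (𝕊 M) (λ ρ → lookup ρ i ≡ lookup ρ j)
  equalᵈ i j = i ≐ j , λ _ → ⇔-id _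

  eqLengthᵈ : (i j : Fin n) → Definable (𝕊 M) (λ ρ → length (lookup ρ i) ≡ length (lookup ρ j))
  eqLengthᵈ i j = rel eqLength (i ∷ j ∷ []) , λ _ → ⇔-id _

  emptyᵈ : (i : Fin n) → Definable (𝕊 M) (λ ρ → lookup ρ i ≡ [])
  emptyᵈ i = definable-resp
    (λ ρ → mk⇔ (λ h → minimal (h [])) (λ eq y → subst (λ x → Prefix _≡_ x y) (sym eq) []))
    (∀ᵈ (prefixᵈ (suc i) zero))
    where
    minimal : {x : List (Carrier M)} → Prefix _≡_ x [] → x ≡ []
    minimal [] = refl

  -- A nonempty word covers the prefix that omits its last letter, and `eqLength` compares that
  -- prefix with the other word.
  sucLengthᵈ : (i j : Fin n) →
    Definable (𝕊 M) (λ ρ → length (lookup ρ j) ≡ suc (length (lookup ρ i)))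
  sucLengthᵈ i j = definable-resp
    (λ ρ → mk⇔
      (λ (q , c , eq) → trans (covers-length _ q c) (cong suc eq))
      (λ eq → take (length (lookup ρ i)) (lookup ρ j) , covers-take _ (lookup ρ j) eq))
    (∃ᵈ ((prefixᵈ zero (suc j) ∧ᵈ ¬ᵈ equalᵈ zero (suc j) ∧ᵈ
          ∀ᵈ (prefixᵈ zero (suc (suc j)) ⇒ᵈ equalᵈ zero (suc (suc j)) ∨ᵈ prefixᵈ zero (suc zero)))
         ∧ᵈ eqLengthᵈ zero (suc i)))

  lastLettersᵈ : (r : Symbol L) (is : Vec (Fin n) (arity L r)) →
    Definable (𝕊 M) (λ ρ → LastLetters (⟦ M ⟧ r) (λ k → lookup ρ (lookup is k)))
  lastLettersᵈ r is = rel (lastLetters r) is , λ ρ → ⇔-sym (lastLetters-sem M r _) ⇔-∘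
    lastLetters-cong (⟦ M ⟧ r) (λ k → sym (lookup-map k (lookup ρ) is))

  eqLastᵈ : (is : Vec (Fin n) 2) → Definable (𝕊 M) (λ ρ → LastLetters Equal (λ k → lookup ρ (lookup is k)))
  eqLastᵈ (i ∷ j ∷ []) = rel eqLast (i ∷ j ∷ []) , λ ρ → ⇔-sym (eqLast-sem M _ _) ⇔-∘
    lastLetters-cong Equal (λ k → sym (lookup-map k (lookup ρ) (i ∷ j ∷ [])))

  -- The word `z` stands for a position through its length. For each tape the prefix one letter
  -- longer than `z` is guessed, and a relation between last letters thereby becomes a relation
  -- between the letters of a column.
  columnᵈ : {α : Vec (Carrier M) m → Set} →
    (∀ {l} (is : Vec (Fin l) m) → Definable (𝕊 M) (λ ρ → LastLetters α (λ k → lookup ρ (lookup is k)))) →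
    (z : Fin n) (x : Fin m → Fin n) →
    Definable (𝕊 M) (λ ρ → ∃[ a ] (α a × (∀ k → letter (length (lookup ρ z)) (lookup ρ (x k)) ≡ just (lookup a k))))
  columnᵈ {m = m} {n = n} {α = α} d z x = definable-resp (λ ρ → mk⇔ (forth ρ) (back ρ))
    (∃ᵈ* m (d is ∧ᵈ ⋀ᵈ λ k → prefixᵈ (k ↑ˡ n) (m ↑ʳ x k) ∧ᵈ sucLengthᵈ (m ↑ʳ z) (k ↑ˡ n)))
    where
    is : Vec (Fin (m + n)) m
    is = Vec.tabulate (_↑ˡ n)

    word : ∀ (v : Vec (List (Carrier M)) m) ρ k → lookup (v ++ ρ) (lookup is k) ≡ lookup v k
    word v ρ k = trans (cong (lookup (v ++ ρ)) (lookup∘tabulate (_↑ˡ n) k)) (lookup-++ˡ v ρ k)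

    Source Target : Vec (List (Carrier M)) n → Set
    Source ρ = Σ[ v ∈ Vec (List (Carrier M)) m ] (LastLetters α (λ k → lookup (v ++ ρ) (lookup is k)) ×
      (∀ k → Prefix _≡_ (lookup (v ++ ρ) (k ↑ˡ n)) (lookup (v ++ ρ) (m ↑ʳ x k)) ×
             length (lookup (v ++ ρ) (k ↑ˡ n)) ≡ suc (length (lookup (v ++ ρ) (m ↑ʳ z)))))
    Target ρ = ∃[ a ] (α a × (∀ k → letter (length (lookup ρ z)) (lookup ρ (x k)) ≡ just (lookup a k)))

    forth : ∀ ρ → Source ρ → Target ρ
    forth ρ (v , (ℓ , a , h , e) , p) = a , h , λ k → from (letter⇔prefix _ _ _)
      ( lookup v k
      , subst₂ (Prefix _≡_) (lookup-++ˡ v ρ k) (lookup-++ʳ v ρ (x k)) (proj₁ (p k))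
      , subst₂ (λ y t → length y ≡ suc (length t)) (lookup-++ˡ v ρ k) (lookup-++ʳ v ρ z) (proj₂ (p k))
      , subst (λ y → last y ≡ just (lookup a k)) (word v ρ k) (proj₂ (e k)))

    back : ∀ ρ → Target ρ → Source ρ
    back ρ (a , h , eq) = v
      , (length (lookup ρ z) , a , h , λ k → subst (λ y → EndsAt _ y (lookup a k))
          (sym (trans (word v ρ k) (lookup∘tabulate _ k))) (proj₂ (proj₂ (split k))))
      , λ k → let eqₖ = sym (trans (lookup-++ˡ v ρ k) (lookup∘tabulate (λ k → proj₁ (split k)) k)) in
          subst₂ (Prefix _≡_) eqₖ (sym (lookup-++ʳ v ρ (x k))) (proj₁ (proj₂ (split k)))
        , subst₂ (λ y t → length y ≡ suc (length t)) eqₖ (sym (lookup-++ʳ v ρ z))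
            (proj₁ (proj₂ (proj₂ (split k))))
      where
      split = λ k → to (letter⇔prefix (length (lookup ρ z)) (lookup ρ (x k)) (lookup a k)) (eq k)
      v = Vec.tabulate (λ k → proj₁ (split k))

  sharedᵈ : (z x y : Fin n) → Definable (𝕊 M) (λ ρ → Shared (length (lookup ρ z)) (lookup ρ x) (lookup ρ y))
  sharedᵈ z x y = definable-resp
    (λ ρ → mk⇔ (λ { (a ∷ .a ∷ [] , refl , eq) → a , eq zero , eq (suc zero) })
               (λ (a , eq , eq′) → a ∷ a ∷ [] , refl , λ { zero → eq ; (suc zero) → eq′ }))
    (columnᵈ eqLastᵈ z (lookup (x ∷ y ∷ [])))

  -- `Shared` compares existing letters only; equality in the enlarged domain needs a second case,
  -- in which both words have already ended.
  letterEqual⇔ : ∀ i (x y : List (Carrier M)) {c d} → letter i x ≡ c → letter i y ≡ d →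
    (Shared i x y ⊎ ¬ Shared i x x × ¬ Shared i y y) ⇔ (c ≡ d)
  letterEqual⇔ i x y refl refl with letter i x | letter i y
  ... | nothing | nothing = mk⇔ (λ _ → refl) (λ _ → inj₂ ((λ { (_ , () , _) }) , (λ { (_ , () , _) })))
  ... | nothing | just b  = mk⇔
    (λ { (inj₁ (_ , () , _)) ; (inj₂ (_ , h)) → contradiction (b , refl , refl) h }) (λ ())
  ... | just a  | nothing = mk⇔
    (λ { (inj₁ (_ , _ , ())) ; (inj₂ (h , _)) → contradiction (a , refl , refl) h }) (λ ())
  ... | just a  | just b  = mk⇔
    (λ { (inj₁ (_ , refl , refl)) → refl ; (inj₂ (h , _)) → contradiction (a , refl , refl) h })
    (λ { refl → inj₁ (a , refl , refl) })

  letterNothing⇔ : ∀ i (x : List (Carrier M)) {c} → letter i x ≡ c → (¬ Shared i x x) ⇔ (c ≡ nothing)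
  letterNothing⇔ i x refl with letter i x
  ... | nothing = mk⇔ (λ _ → refl) (λ { _ (_ , () , _) })
  ... | just a  = mk⇔ (λ h → contradiction (a , refl , refl) h) (λ ())

  letters : ℕ → Vec (Fin n) m → Vec (List (Carrier M)) n → Vec (Maybe (Carrier M)) m
  letters i σ ρ = Vec.map (λ x → letter i (lookup ρ x)) σ

  -- Makes quantification over words agree with quantification over letters and #: the empty word
  -- supplies #, and filling with `a₀` moves a letter to the required position.
  letter-surjective : (a₀ : Carrier M) (i : ℕ) (c : Maybe (Carrier M)) → ∃[ x ] letter i x ≡ c
  letter-surjective a₀ i       nothing  = [] , cong head (drop-[] i)
  letter-surjective a₀ zero    (just a) = a ∷ [] , refl
  letter-surjective a₀ (suc i) (just a) = let x , eq = letter-surjective a₀ i (just a) in a₀ ∷ x , eq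

  module _ (a₀ : Carrier M) where

    -- Words, read at the position given by z, stand for elements of Σ ∪ {#}.
    formulaᵈ : (φ : Formula (L #) m) (z : Fin n) (σ : Vec (Fin n) m) →
      Definable (𝕊 M) (λ ρ → extend M ⊨ φ [ letters (length (lookup ρ z)) σ ρ ])
    formulaᵈ (rel (old r) xs) z σ = definable-resp
      (λ ρ → let at = λ k → lookup-map (lookup xs k) (λ x → letter (length (lookup ρ z)) (lookup ρ x)) σ in
         ⇔-sym (old-sem M r xs (letters (length (lookup ρ z)) σ ρ)) ⇔-∘
         ∃-cong (λ a → ⇔-id _ ×-⇔ ∀-cong (λ k → mk⇔ (trans (at k)) (trans (sym (at k))))))
      (columnᵈ (lastLettersᵈ r) z (λ k → lookup σ (lookup xs k)))
    formulaᵈ (rel P# (x ∷ [])) z σ = definable-resp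
      (λ ρ → letterNothing⇔ (length (lookup ρ z)) (lookup ρ (lookup σ x)) (sym (lookup-map x _ σ)))
      (¬ᵈ sharedᵈ z (lookup σ x) (lookup σ x))
    formulaᵈ (x ≐ y) z σ = definable-resp
      (λ ρ → letterEqual⇔ (length (lookup ρ z)) (lookup ρ (lookup σ x)) (lookup ρ (lookup σ y))
               (sym (lookup-map x _ σ)) (sym (lookup-map y _ σ)))
      (sharedᵈ z (lookup σ x) (lookup σ y) ∨ᵈ
       ¬ᵈ sharedᵈ z (lookup σ x) (lookup σ x) ∧ᵈ ¬ᵈ sharedᵈ z (lookup σ y) (lookup σ y))
    formulaᵈ (∼ φ)    z σ = ¬ᵈ formulaᵈ φ z σ
    formulaᵈ (φ ∧′ ψ) z σ = formulaᵈ φ z σ ∧ᵈ formulaᵈ ψ z σ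
    formulaᵈ (φ ∨′ ψ) z σ = formulaᵈ φ z σ ∨ᵈ formulaᵈ ψ z σ
    formulaᵈ (φ ⇒′ ψ) z σ = formulaᵈ φ z σ ⇒ᵈ formulaᵈ ψ z σ
    formulaᵈ (all′ φ) z σ = definable-resp
      (λ ρ → mk⇔
        (λ h c → let y , eq = letter-surjective a₀ (length (lookup ρ z)) c in
           subst₂ (λ d u → extend M ⊨ φ [ d ∷ u ]) eq (sym (map-∘ _ suc σ)) (h y))
        (λ h y → subst (λ u → extend M ⊨ φ [ _ ∷ u ]) (map-∘ _ suc σ) (h _)))
      (∀ᵈ (formulaᵈ φ (suc z) (zero ∷ Vec.map suc σ)))
    formulaᵈ (ex′ φ)  z σ = definable-resp
      (λ ρ → mk⇔
        (λ (y , h) → _ , subst (λ u → extend M ⊨ φ [ _ ∷ u ]) (sym (map-∘ _ suc σ)) h)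
        (λ (c , h) → let y , eq = letter-surjective a₀ (length (lookup ρ z)) c in
           y , subst₂ (λ d u → extend M ⊨ φ [ d ∷ u ]) (sym eq) (map-∘ _ suc σ) h))
      (∃ᵈ (formulaᵈ φ (suc z) (zero ∷ Vec.map suc σ)))

-- Definability of acceptance

suffix : ℕ → Vec (List A) n → Vec (List A) n
suffix i = Vec.map (drop i)

heads-suffix : ∀ i (w : Vec (List A) n) → heads (suffix i w) ≡ Vec.map (letter i) w
heads-suffix i w = sym (map-∘ head (drop i) w)

tails-suffix : ∀ i (w : Vec (List A) n) → tails (suffix i w) ≡ suffix (suc i) w
tails-suffix i w = trans (sym (map-∘ (drop 1) (drop i) w))
  (map-cong (λ x → trans (drop-drop i 1 x) (cong (λ k → drop k x) (+-comm i 1))) w)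

Active : ℕ → Vec (List A) n → Set
Active i w = ∃[ j ] Shared i (lookup w j) (lookup w j)

head⇔nonempty : (v : Vec (List A) n) → (∃[ j ] ∃[ a ] head (lookup v j) ≡ just a) ⇔ (maxLength v ≢ 0)
head⇔nonempty []            = mk⇔ (λ ()) (λ h → contradiction refl h)
head⇔nonempty ([] ∷ v)      = mk⇔
  (λ { (zero , _ , ()) ; (suc j , h) → to (head⇔nonempty v) (j , h) })
  (λ v≢ε → let j , h = from (head⇔nonempty v) v≢ε in suc j , h)
head⇔nonempty ((a ∷ x) ∷ v) = mk⇔
  (λ _ → (λ ()) ∘ m⊔n≡0⇒m≡0 (suc (length x)) (maxLength v))
  (λ _ → zero , a , refl)

-- Replaces the maximal length, which is not in the language of `𝕊 M`, by a finite disjunction over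
-- the tapes.
active⇔ : ∀ i (w : Vec (List A) n) → Active i w ⇔ (maxLength (suffix i w) ≢ 0)
active⇔ i w = mk⇔ (to (head⇔nonempty (suffix i w)) ∘ forth) (back ∘ from (head⇔nonempty (suffix i w)))
  where
  HasHead : Set
  HasHead = ∃[ j ] ∃[ a ] head (lookup (suffix i w) j) ≡ just a
  forth : Active i w → HasHead
  forth (j , a , eq , _) = j , a , trans (cong head (lookup-map j (drop i) w)) eq
  back : HasHead → Active i w
  back (j , a , eq) = let eq′ = trans (sym (cong head (lookup-map j (drop i) w))) eq in j , a , eq′ , eq′

letter-applyUpTo : ∀ (f : ℕ → A) l i {a} → (letter i (applyUpTo f l) ≡ just a) ⇔ (i < l × f i ≡ a)
letter-applyUpTo f zero    i       = mk⇔
  (λ eq → contradiction (trans (sym (cong head (drop-[] i))) eq) λ ()) (λ ())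
letter-applyUpTo f (suc l) zero    = mk⇔ (λ { refl → z<s , refl }) (λ { (_ , refl) → refl })
letter-applyUpTo f (suc l) (suc i) =
  mk⇔ (λ (i<l , eq) → s<s i<l , eq) (λ (i<l , eq) → s<s⁻¹ i<l , eq) ⇔-∘ letter-applyUpTo (f ∘ suc) l i

module _ (M : Structure L) (𝒜 : Automaton L n) where
  open Automaton 𝒜 using (initial; terminal; transitions) renaming (size to states)

  private
    Word : Set
    Word = List (Carrier M)

  -- Positions are not individuals of `𝕊 M`; the words `z` and `z′` represent them by their lengths.
  -- The transition ranges over a finite list and so becomes a disjunction.
  Continues : (Fin states → Word) → Word → Vec Word n → Word → Fin states → Set
  Continues x y w z q =
    (Active (length z) w ×
     (∃[ t ] (t ∈ transitions × proj₁ t ≡ q ×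
       (extend M ⊨ proj₁ (proj₂ t) [ Vec.map (letter (length z)) w ]) ×
       (Σ[ z′ ∈ Word ] (length z′ ≡ suc (length z) × Shared (length z′) (x (proj₂ (proj₂ t))) y))))) ⊎
    (¬ Active (length z) w × q ∈ₛ terminal)

  -- In the intended marking, the positions of q are those from which the rest
  -- of the word is accepted from q.
  Marking : (Fin states → Word) → Word → Vec Word n → Set
  Marking x y w =
    (Σ[ z ∈ Word ] (z ≡ [] × (∃[ q ] (q ∈ₛ initial × Shared (length z) (x q) y)))) ×
    (∀ z q → Shared (length z) (x q) y → Continues x y w z q)

  -- Any marking closed under `Continues` will do, not just the intended one: following marked
  -- positions yields an accepting run, by induction on the number `l` of columns still to be read.
  marking-sound : ∀ {x y w} → (∀ z q → Shared (length z) (x q) y → Continues x y w z q) →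
    ∀ l z q → maxLength w ∸ length z ≡ l → Shared (length z) (x q) y →
    AcceptsFrom M 𝒜 q ⟨ suffix (length z) w ⟩
  marking-sound {x} {y} {w} continues l z q eq marked with continues z q marked
  ... | inj₂ (¬active , t) = subst (AcceptsFrom M 𝒜 q) (sym (⟨⟩-empty _ (empty _ refl))) t
    where
    empty : ∀ k → maxLength (suffix (length z) w) ≡ k → maxLength (suffix (length z) w) ≡ 0
    -- Distinguishing cases on the number of remaining columns turns the negated `Active` into an
    -- equation.
    empty zero    eq = eq
    empty (suc k) eq = contradiction (from (active⇔ (length z) w)
      (λ eq₀ → contradiction (trans (sym eq) eq₀) λ ())) ¬active
  marking-sound {w = w} continues zero z q eq _ | inj₁ (active , _) =
    contradiction (trans (maxLength-drop (length z) w) eq) (to (active⇔ (length z) w) active)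
  marking-sound {w = w} continues (suc l) z q eq _
    | inj₁ (active , (_ , φ , q′) , mem , refl , h , z′ , len , marked) =
    subst (AcceptsFrom M 𝒜 q) (sym (⟨⟩-nonempty _ (to (active⇔ (length z) w) active)))
      ( q′
      , (φ , mem , subst (λ u → extend M ⊨ φ [ u ]) (sym (heads-suffix (length z) w)) h)
      , subst (λ v → AcceptsFrom M 𝒜 q′ ⟨ v ⟩)
          (trans (cong (λ k → suffix k w) len) (sym (tails-suffix (length z) w)))
          (marking-sound continues l z′ q′
            (trans (cong (maxLength w ∸_) len)
              (trans (sym (pred[m∸n]≡m∸[1+n] (maxLength w) (length z))) (cong pred eq))) marked))

  module _ (em : ExcludedMiddle 0ℓ) {a b : Carrier M} (a≢b : a ≢ b) (w : Vec Word n) where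

    private
      Live : ℕ → Fin states → Set
      Live i q = AcceptsFrom M 𝒜 q ⟨ suffix i w ⟩

    -- The length exceeds that of the convolution by one, because a run has one more state than
    -- there are columns.
    reference : Word
    reference = applyUpTo (λ _ → a) (suc (maxLength w))

    -- Agreement with `reference` puts a position into the set, and `b` serves to disagree; this
    -- uses that the two letters differ.
    mark-letter : Fin states → ℕ → Carrier M
    mark-letter q i = if isYes (em {Live i q}) then a else b

    mark : Fin states → Word
    mark q = applyUpTo (mark-letter q) (suc (maxLength w))

    module _ {x : Fin states → Word} (x≗mark : ∀ q → x q ≡ mark q) where

      shared⇔live : ∀ i q → Shared i (x q) reference ⇔ (i < suc (maxLength w) × Live i q)
      shared⇔live i q rewrite x≗mark q = mk⇔
        (λ (c , eq , eq′) →
           let i<l , m = to (letter-applyUpTo (mark-letter q) _ i) eq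
               _ , a≡c = to (letter-applyUpTo (λ _ → a) (suc (maxLength w)) i) eq′ in
           i<l , to decided (trans m (sym a≡c)))
        (λ (i<l , live) → a , from (letter-applyUpTo (mark-letter q) _ i) (i<l , from decided live)
                            , from (letter-applyUpTo (λ _ → a) _ i) (i<l , refl))
        where
        decided : (mark-letter q i ≡ a) ⇔ Live i q
        decided with em {Live i q}
        ... | yes live  = mk⇔ (λ _ → live) (λ _ → refl)
        ... | no  ¬live = mk⇔ (λ b≡a → contradiction (sym b≡a) a≢b) (λ live → contradiction live ¬live)

      marking-complete : ∀ {q} → q ∈ₛ initial → Live 0 q → Marking x reference w
      marking-complete {q₀} init live₀ =
        ([] , refl , q₀ , init , from (shared⇔live 0 q₀) (z<s , live₀)) , continues
        where
        continues : ∀ z q → Shared (length z) (x q) reference → Continues x reference w z q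
        continues z q marked with to (shared⇔live (length z) q) marked
        ... | i<l , live with em {maxLength (suffix (length z) w) ≡ 0}
        ... | yes w≡ε = inj₂
          ( (λ active → to (active⇔ (length z) w) active w≡ε)
          , subst (AcceptsFrom M 𝒜 q) (⟨⟩-empty _ w≡ε) live )
        ... | no w≢ε with subst (AcceptsFrom M 𝒜 q) (⟨⟩-nonempty _ w≢ε) live
        ... | q′ , (φ , mem , h) , live′ = inj₁
          ( from (active⇔ (length z) w) w≢ε
          , (q , φ , q′) , mem , refl
          , subst (λ u → extend M ⊨ φ [ u ]) (heads-suffix (length z) w) h
          -- Any word one letter longer than `z` represents the next position. It is within the
          -- range of the marks because a column at `length z` exists.
          , a ∷ z , refl , from (shared⇔live (suc (length z)) q′)
              ( s<s (m∸n≢0⇒n<m (w≢ε ∘ trans (maxLength-drop (length z) w)))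
              , subst (λ v → AcceptsFrom M 𝒜 q′ ⟨ v ⟩) (tails-suffix (length z) w) live′ ))

  states-of : Vec Word states → Word → Vec Word n → Fin states → Word
  states-of x y w q = lookup (x ++ y ∷ w) (q ↑ˡ suc n)

  -- One reference word `y` is shared by all states, so the sets of all states are coded by one word
  -- each and `y`.
  accepts⇔marking : ExcludedMiddle 0ℓ → AtLeastTwo (Carrier M) → ∀ w →
    (∃[ y ] ∃[ x ] Marking (states-of x y w) y w) ⇔ Accepts M 𝒜 w
  accepts⇔marking em (a , b , a≢b) w = ⇔-sym (accepts⇔ M 𝒜 w) ⇔-∘ mk⇔
    (λ { (y , x , (.[] , refl , q , init , marked) , continues) →
         q , init , subst (λ v → AcceptsFrom M 𝒜 q ⟨ v ⟩) (map-id w)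
           (marking-sound continues _ [] q refl marked) })
    (λ (q , init , h) → reference em a≢b w , Vec.tabulate (mark em a≢b w) ,
         marking-complete em a≢b w
           (λ p → trans (lookup-++ˡ (Vec.tabulate (mark em a≢b w)) (reference em a≢b w ∷ w) p)
                        (lookup∘tabulate (mark em a≢b w) p))
           init (subst (λ v → AcceptsFrom M 𝒜 q ⟨ v ⟩) (sym (map-id w)) h))

  module _ (a₀ : Carrier M) where

    continuesᵈ : ∀ {N} (x : Fin states → Fin N) (y : Fin N) (w : Vec (Fin N) n) (z : Fin N) (q : Fin states) →
      Definable (𝕊 M) (λ ρ → Continues (lookup ρ ∘ x) (lookup ρ y) (Vec.map (lookup ρ) w) (lookup ρ z) q)
    continuesᵈ x y w z q =
      (activeᵈ ∧ᵈ ∈ᵈ transitions (λ (p , φ , q′) → constᵈ (p ≟ q) ∧ᵈ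
        definable-subst (λ u _ → extend M ⊨ φ [ u ]) (λ ρ → map-∘ (letter (length (lookup ρ z))) (lookup ρ) w)
          (formulaᵈ M a₀ φ z w) ∧ᵈ
        ∃ᵈ (sucLengthᵈ M (suc z) zero ∧ᵈ sharedᵈ M zero (suc (x q′)) (suc y)))) ∨ᵈ
      (¬ᵈ activeᵈ ∧ᵈ constᵈ (q ∈? terminal))
      where
      activeᵈ : Definable (𝕊 M) (λ ρ → Active (length (lookup ρ z)) (Vec.map (lookup ρ) w))
      activeᵈ = ⋁ᵈ λ j → definable-subst (λ v ρ → Shared (length (lookup ρ z)) v v)
        (λ ρ → sym (lookup-map j (lookup ρ) w)) (sharedᵈ M z (lookup w j) (lookup w j))

    markingᵈ : ∀ {N} (x : Fin states → Fin N) (y : Fin N) (w : Vec (Fin N) n) →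
      Definable (𝕊 M) (λ ρ → Marking (lookup ρ ∘ x) (lookup ρ y) (Vec.map (lookup ρ) w))
    markingᵈ x y w =
      ∃ᵈ (emptyᵈ M zero ∧ᵈ ⋁ᵈ λ q → constᵈ (q ∈? initial) ∧ᵈ sharedᵈ M zero (suc (x q)) (suc y)) ∧ᵈ
      ∀ᵈ (⋀ᵈ λ q → sharedᵈ M zero (suc (x q)) (suc y) ⇒ᵈ
        definable-subst (λ v ρ → Continues (lookup ρ ∘ suc ∘ x) (lookup ρ (suc y)) v (lookup ρ zero) q)
          (λ ρ → sym (map-∘ (lookup ρ) suc w))
          (continuesᵈ (suc ∘ x) (suc y) (Vec.map suc w) zero q))

  accepts-definable : ExcludedMiddle 0ℓ → AtLeastTwo (Carrier M) → Definable (𝕊 M) (Accepts M 𝒜)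
  accepts-definable em two = definable-resp (accepts⇔marking em two)
    (∃ᵈ (definable-resp {R = Marked} {S = Marked′}
      (λ { (y ∷ w) → ∃-cong λ x → subst₂
             (λ y′ w′ → Marking (states-of x y w) y′ w′ ⇔ Marking (states-of x y w) y w)
             (sym (lookup-++ʳ x (y ∷ w) zero)) (sym (tapes x y w)) (⇔-id _) })
      (∃ᵈ* states (markingᵈ (proj₁ two) (_↑ˡ suc n) (states ↑ʳ zero) tape-indices))))
    where
    tape-indices : Vec (Fin (states + suc n)) n
    -- The variables are, in this order, the words of the states, the reference word and the tapes.
    tape-indices = Vec.tabulate (λ j → states ↑ʳ suc j)

    Marked Marked′ : Vec Word (suc n) → Set
    Marked ρ = Σ[ x ∈ Vec Word states ] Marking (lookup (x ++ ρ) ∘ (_↑ˡ suc n))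
      (lookup (x ++ ρ) (states ↑ʳ zero)) (Vec.map (lookup (x ++ ρ)) tape-indices)
    Marked′ (y ∷ w) = ∃[ x ] Marking (states-of x y w) y w

    tapes : ∀ x y w → Vec.map (lookup (x ++ y ∷ w)) tape-indices ≡ w
    tapes x y w = lookup-ext λ j → trans (lookup-map j (lookup (x ++ y ∷ w)) tape-indices)
      (trans (cong (lookup (x ++ y ∷ w)) (lookup∘tabulate _ j)) (lookup-++ʳ x (y ∷ w) (suc j)))

recognizable⇒definable : ExcludedMiddle 0ℓ → (M : Structure L) → AtLeastTwo (Carrier M) →
  {R : Pred (Vec (List (Carrier M)) n) 0ℓ} → Recognizable M R → Definable (𝕊 M) R
recognizable⇒definable em M two (𝒜 , R⇔Accepts) =
  definable-resp (λ w → ⇔-sym (R⇔Accepts w)) (accepts-definable M 𝒜 em two)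

theorem3p12 : (k : ℕ) (ar : Fin k → ℕ) →
    (ExcludedMiddle 0ℓ →
    (M : Structure (relational k ar)) → AtLeastTwo (Carrier M) →
    (n : ℕ) → 1 ≤ n → (R : Pred (Vec (List (Carrier M)) n) 0ℓ) →
    Recognizable M R ⇔ Definable (𝕊 M) R)
    ×
    (Σ[ red ∈ (Sentence (𝕊ᴸ (relational k ar)) → Sentence (relational k ar)) ]
    (ExcludedMiddle 0ℓ →
    (M : Structure (relational k ar)) → AtLeastTwo (Carrier M) →
    red Reduces (Theory (𝕊 M)) to (Theory M)))
theorem3p12 k ar =
  (λ em M two n _ R → mk⇔ (recognizable⇒definable em M two) (definable⇒recognizable em M)) ,
  -- Effectiveness: `reduce` depends on the language alone and is given before excluded middle and
  -- `M` are.
  reduce , λ em M _ → reduce-reduces em M
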